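{- Let $p$ be a prime, $q=p^l$, $n\ge 2$ and $k\ge1$ integers, and $d=\gcd(k,q-1)$. If $\gcd\big((q-1)/d,\,p-1\big)\ge 3$ (equivalently, the cyclic group $\mathbb F_p^\times\cap\{x^d\mid x\in\mathbb F_q\}$ has at least 3 elements) and $n>p-1$, then every cyclic matrix $A\in M_n(\mathbb F_q)$ with $\operatorname{Tr}(A)\in\mathbb F_p$ is of the form $B^k+C^k$ with $B,C\in M_n(\mathbb F_q)$.
   Context: A matrix $A\in M_n(K)$ is cyclic if its minimal polynomial equals its characteristic polynomial. -}

module Defs where

open import Level using (Level; _⊔_)
open import Algebra.Bundles using (CommutativeRing)
open import Data.Nat as ℕ using (ℕ; zero; suc)
open import Data.Nat.DivMod using (_/_)
open import Data.Fin using (Fin; zero; suc; punchIn; _≟_)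
open import Data.List using (List; []; _∷_; length; map; last)
open import Data.Maybe using (Maybe; just; nothing)
open import Data.Product using (Σ; ∃; _×_)
open import Data.Empty using (⊥)
open import Relation.Nullary using (¬_; yes; no)
open import Relation.Binary.PropositionalEquality as ≡ using (_≡_)
open import Function.Bundles using (Inverse)

-- natural-number division m / d for d ≥ 1 (value at d = 0 is irrelevant here)
divNat : ℕ → ℕ → ℕ
divNat m zero    = zero
divNat m (suc d) = m / suc d

module _ {a} {A : Set a} (_⊕_ _⊗_ : A → A → A) (neg : A → A) (0a 1a : A) where
  altSum : (m : ℕ) → (Fin m → A) → A
  altSum zero    f = 0a
  altSum (suc m) f = f zero ⊕ neg (altSum m (λ j → f (suc j)))

  detWith : (n : ℕ) → (Fin n → Fin n → A) → A
  detWith zero    M = 1a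
  detWith (suc n) M =
    altSum (suc n) (λ j → M zero j ⊗ detWith n (λ r c → M (suc r) (punchIn j c)))

module _ {c ℓ} (R : CommutativeRing c ℓ) where
  open CommutativeRing R using (Carrier; _≈_; _+_; _*_; -_; 0#; 1#; setoid)

  IsField : Set (c ⊔ ℓ)
  IsField = ¬ (0# ≈ 1#) × (∀ x → ¬ (x ≈ 0#) → ∃ λ y → x * y ≈ 1#)

  HasCard : ℕ → Set (c ⊔ ℓ)
  HasCard q = Inverse setoid (≡.setoid (Fin q))

  -- image of ℕ in R (the prime subfield, in positive characteristic)
  fromℕ : ℕ → Carrier
  fromℕ zero    = 0#
  fromℕ (suc m) = 1# + fromℕ m

  InPrimeSubfield : Carrier → Set ℓ
  InPrimeSubfield x = ∃ λ m → x ≈ fromℕ m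

  Mat : ℕ → Set c
  Mat n = Fin n → Fin n → Carrier

  _≈M_ : {n : ℕ} → Mat n → Mat n → Set ℓ
  M ≈M N = ∀ i j → M i j ≈ N i j

  sumFin : (n : ℕ) → (Fin n → Carrier) → Carrier
  sumFin zero    f = 0#
  sumFin (suc n) f = f zero + sumFin n (λ i → f (suc i))

  zeroM : {n : ℕ} → Mat n
  zeroM i j = 0#

  idM : {n : ℕ} → Mat n
  idM i j with i ≟ j
  ... | yes _ = 1#
  ... | no  _ = 0#

  _+M_ : {n : ℕ} → Mat n → Mat n → Mat n
  (M +M N) i j = M i j + N i j

  _*M_ : {n : ℕ} → Mat n → Mat n → Mat n
  _*M_ {n} M N i j = sumFin n (λ t → M i t * N t j)

  scaleM : {n : ℕ} → Carrier → Mat n → Mat n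
  scaleM a M i j = a * M i j

  _^M_ : {n : ℕ} → Mat n → ℕ → Mat n
  M ^M zero  = idM
  M ^M suc k = M *M (M ^M k)

  trace : {n : ℕ} → Mat n → Carrier
  trace {n} M = sumFin n (λ i → M i i)

  -- polynomials over R: coefficient lists, lowest degree first
  Poly : Set c
  Poly = List Carrier

  _+P_ : Poly → Poly → Poly
  []       +P g        = g
  (a ∷ f)  +P []       = a ∷ f
  (a ∷ f)  +P (b ∷ g)  = (a + b) ∷ (f +P g)

  _*P_ : Poly → Poly → Poly
  []      *P g = []
  (a ∷ f) *P g = map (a *_) g +P (0# ∷ (f *P g))

  negP : Poly → Poly
  negP = map (-_)

  -- monic: nonempty with leading (last) coefficient 1; degree = length ∸ 1
  Monic : Poly → Set ℓ
  Monic f with last f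
  ... | nothing = Lift⊥
    where Lift⊥ = Level.Lift ℓ ⊥
  ... | just a  = a ≈ 1#

  evalM : {n : ℕ} → Poly → Mat n → Mat n
  evalM []      M = zeroM
  evalM (a ∷ f) M = scaleM a idM +M (M *M evalM f M)

  charPoly : {n : ℕ} → Mat n → Poly
  charPoly {n} A = detWith _+P_ _*P_ negP [] (1# ∷ []) n xI-A
    where
      xI-A : Fin n → Fin n → Poly
      xI-A i j with i ≟ j
      ... | yes _ = (- A i j) ∷ 1# ∷ []
      ... | no  _ = (- A i j) ∷ []

  IsMinimalPoly : {n : ℕ} → Mat n → Poly → Set (c ⊔ ℓ)
  IsMinimalPoly A m =
    Monic m × (evalM m A ≈M zeroM) ×
    (∀ f → Monic f → evalM f A ≈M zeroM → length m ℕ.≤ length f)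

  Cyclic : {n : ℕ} → Mat n → Set (c ⊔ ℓ)
  Cyclic A = IsMinimalPoly A (charPoly A)

{-# OPTIONS --safe #-}
module Submission where

open import Defs
open import Level using (Level; _⊔_)
open import Algebra.Bundles using (CommutativeMonoid; CommutativeRing)
import Algebra.Properties.AbelianGroup
import Algebra.Properties.CommutativeMonoid.Sum
import Algebra.Properties.CommutativeSemiring.Exp
import Algebra.Properties.Group
import Algebra.Properties.Monoid.Mult
import Algebra.Properties.Ring
import Algebra.Properties.Semiring.Mult.TCOptimised
import Algebra.Solver.Ring
open import Algebra.Solver.Ring.AlmostCommutativeRing using (fromCommutativeRing; _-Raw-AlmostCommutative⟶_; Induced-equivalence)
open import Data.Bool using (Bool; true; false; not; if_then_else_)
open import Data.Empty using (⊥; ⊥-elim)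
open import Data.Fin as Fin using (Fin; zero; suc; toℕ; fromℕ<; finToFun; funToFin; inject₁; inject≤; punchIn; punchOut)
open import Data.Fin.Patterns using (0F; 1F; 2F; 3F)
open import Data.Fin.Permutation using (Permutation; permutation)
import Data.Fin.Properties as FinP
open import Data.Fin.Relation.Unary.Top using (view; ‵fromℕ; ‵inject₁)
open import Data.Integer as ℤ using (ℤ; +_; -[1+_]; _⊖_)
import Data.Integer.Properties as ℤP
open import Data.List using ([]; _∷_; _++_; length; map; last)
open import Data.List.Properties using (length-++; length-map)
open import Data.Maybe using (just; nothing)
open import Data.Nat as ℕ using (ℕ; zero; suc; _≤_; _<_; z≤n; s≤s; _∸_; NonZero)
open import Data.Nat.Coprimality using (prime⇒coprime; coprime-Bézout)
open import Data.Nat.Divisibility using (_∣_; divides)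
open import Data.Nat.DivMod using (_/_; _%_; m≡m%n+[m/n]*n; m%n<n; m/n*n≡m)
open import Data.Nat.GCD using (gcd; gcd[m,n]∣m; gcd[m,n]∣n; gcd-GCD; gcd[m,n]≢0; module Bézout)
open import Data.Nat.Induction using (<-rec)
open import Data.Nat.Primality using (Prime)
import Data.Nat.Properties as ℕP
open import Data.Product using (∃; ∃₂; _×_; _,_; proj₁; proj₂)
open import Data.Sum using (_⊎_; inj₁; inj₂)
open import Data.Unit using (⊤; tt)
open import Function.Base using (_∘_; id)
open import Function.Bundles using (Inverse)
open import Relation.Binary.Bundles using (Setoid)
open import Relation.Binary.Definitions using (WeaklyDecidable; tri<; tri≈; tri>)
open import Relation.Binary.PropositionalEquality as ≡ using (_≡_; _≢_)
import Relation.Binary.Reasoning.Setoid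
open import Relation.Nullary using (¬_; yes; no; Dec; ¬?; contradiction)
open import Relation.Nullary.Decidable using (decidable-stable; map′)

-- Counting roots of x^(2e) - 1 in F_q, with (q-1)/e = gcd((q-1)/d, p-1), gives a k-th power ω in F_p
-- with ω² ≠ 1, so 0, 1, ω and ω² are distinct k-th powers of F_q lying in F_p.
--
-- A cyclic matrix has a cyclic vector u. In the basis w₀ = u, wᵢ₊₁ = (A - ξᵢ - ω) wᵢ with ξᵢ ∈ {0,1}, A has
-- diagonal entries ξᵢ + ω, ones below the diagonal, and otherwise only a last column. Taking ξᵢ = 1 for
-- exactly j of the n - 1 ≥ p - 1 free indices, j is chosen modulo p so that the trace makes the last
-- diagonal entry equal to ω + ω². Distribute the subdiagonal ones alternately over two summands, the
-- bottom one going to B: each summand then consists of 2 × 2 triangular blocks with eigenvalues ξᵢ ≠ ω,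
-- and C has in addition a last column with the new eigenvalue ω². Both are diagonalisable with k-th powers
-- as eigenvalues, hence k-th powers of polynomials in themselves.
--
-- The existence of u is proved classically, under a double negation, which is harmless because the
-- conclusion is a search over the finitely many pairs of matrices.

-- What can be steered is the diagonal of `A`, and a triangular block is diagonalisable as soon as
-- its diagonal entries differ. The last column of `A` is not steered and has to be absorbed by one
-- summand. As `B` owns the bottom subdiagonal entry, `C` maps the span of all `wᵢ` but the last to
-- itself, and the last column does no harm once the corner of `C` is an eigenvalue outside 0, 1, ω.
-- The value ω² is again a k-th power in the prime field; asking it to differ from 1 is what costs a
-- third element in the subgroup. Instead, a monic f with f(A) = 0 is cancelled factor by factor:
-- for f(A) itself even the zero vector will do, and each irreducible factor that is removed
-- corrects the vector if necessary. The factorisation comes from classical case distinctions and a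
-- least-degree argument.

-- Ring solver with integer coefficients.

module IntegerCoefficients {c ℓ} (R : CommutativeRing c ℓ) where
  open CommutativeRing R
  open Algebra.Properties.Ring ring using (-‿distribˡ-*; -‿distribʳ-*)
  open Algebra.Properties.AbelianGroup +-abelianGroup
  open Algebra.Properties.Semiring.Mult.TCOptimised semiring renaming (_×_ to _·_)
  open Relation.Binary.Reasoning.Setoid setoid

  ⟦_⟧ℤ : ℤ → Carrier
  ⟦ + n ⟧ℤ      = n · 1#
  ⟦ -[1+ n ] ⟧ℤ = - (suc n · 1#)

  ⊖-homo : ∀ m n → ⟦ m ⊖ n ⟧ℤ ≈ m · 1# + - (n · 1#)
  ⊖-homo m zero = sym (trans (+-congˡ ε⁻¹≈ε) (+-identityʳ _))
  ⊖-homo zero (suc n) = sym (+-identityˡ _)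
  ⊖-homo (suc m) (suc n) = begin
    ⟦ suc m ⊖ suc n ⟧ℤ                         ≡⟨ ≡.cong ⟦_⟧ℤ (ℤP.[1+m]⊖[1+n]≡m⊖n m n) ⟩
    ⟦ m ⊖ n ⟧ℤ                                 ≈⟨ ⊖-homo m n ⟩
    m · 1# + - (n · 1#)                        ≈⟨ +-congʳ (xyx⁻¹≈y 1# (m · 1#)) ⟨
    1# + m · 1# + - 1# + - (n · 1#)            ≈⟨ +-assoc _ _ _ ⟩
    1# + m · 1# + (- 1# + - (n · 1#))          ≈⟨ +-congˡ (⁻¹-∙-comm 1# (n · 1#)) ⟩
    1# + m · 1# + - (1# + n · 1#)              ≈⟨ +-cong (×-homo-+ 1# 1 m) (-‿cong (×-homo-+ 1# 1 n)) ⟨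
    suc m · 1# + - (suc n · 1#)                ∎

  -‿homoℤ : ∀ i → ⟦ ℤ.- i ⟧ℤ ≈ - ⟦ i ⟧ℤ
  -‿homoℤ (+ zero)  = sym ε⁻¹≈ε
  -‿homoℤ (+ suc n) = refl
  -‿homoℤ -[1+ n ]  = sym (⁻¹-involutive _)

  +-homoℤ : ∀ i j → ⟦ i ℤ.+ j ⟧ℤ ≈ ⟦ i ⟧ℤ + ⟦ j ⟧ℤ
  +-homoℤ (+ m)    (+ n)    = ×-homo-+ 1# m n
  +-homoℤ (+ m)    -[1+ n ] = ⊖-homo m (suc n)
  +-homoℤ -[1+ m ] (+ n)    = trans (⊖-homo n (suc m)) (+-comm _ _)
  +-homoℤ -[1+ m ] -[1+ n ] = begin
    - (suc (suc (m ℕ.+ n)) · 1#)     ≡⟨ ≡.cong (λ k → - (suc k · 1#)) (≡.sym (ℕP.+-suc m n)) ⟩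
    - ((suc m ℕ.+ suc n) · 1#)       ≈⟨ -‿cong (×-homo-+ 1# (suc m) (suc n)) ⟩
    - (suc m · 1# + suc n · 1#)      ≈⟨ ⁻¹-∙-comm _ _ ⟨
    - (suc m · 1#) + - (suc n · 1#)  ∎

  *-homo⁺ : ∀ m j → ⟦ + m ℤ.* j ⟧ℤ ≈ m · 1# * ⟦ j ⟧ℤ
  *-homo⁺ m (+ n) = trans (reflexive (≡.cong ⟦_⟧ℤ (≡.sym (ℤP.pos-* m n)))) (×1-homo-* m n)
  *-homo⁺ m -[1+ n ] = begin
    ⟦ + m ℤ.* -[1+ n ] ⟧ℤ         ≡⟨ ≡.cong ⟦_⟧ℤ (ℤP.neg-distribʳ-* (+ m) (+ suc n)) ⟨
    ⟦ ℤ.- (+ m ℤ.* + suc n) ⟧ℤ    ≈⟨ -‿homoℤ (+ m ℤ.* + suc n) ⟩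
    - ⟦ + m ℤ.* + suc n ⟧ℤ        ≈⟨ -‿cong (*-homo⁺ m (+ suc n)) ⟩
    - (m · 1# * (suc n · 1#))     ≈⟨ -‿distribʳ-* _ _ ⟩
    m · 1# * - (suc n · 1#)       ∎

  *-homoℤ : ∀ i j → ⟦ i ℤ.* j ⟧ℤ ≈ ⟦ i ⟧ℤ * ⟦ j ⟧ℤ
  *-homoℤ (+ m) j = *-homo⁺ m j
  *-homoℤ -[1+ m ] j = begin
    ⟦ -[1+ m ] ℤ.* j ⟧ℤ        ≡⟨ ≡.cong ⟦_⟧ℤ (ℤP.neg-distribˡ-* (+ suc m) j) ⟨
    ⟦ ℤ.- (+ suc m ℤ.* j) ⟧ℤ   ≈⟨ -‿homoℤ (+ suc m ℤ.* j) ⟩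
    - ⟦ + suc m ℤ.* j ⟧ℤ       ≈⟨ -‿cong (*-homo⁺ (suc m) j) ⟩
    - (suc m · 1# * ⟦ j ⟧ℤ)    ≈⟨ -‿distribˡ-* _ _ ⟩
    - (suc m · 1#) * ⟦ j ⟧ℤ    ∎

  ℤ⟶R : ℤ.+-*-rawRing -Raw-AlmostCommutative⟶ fromCommutativeRing R
  ℤ⟶R = record
    { ⟦_⟧ = ⟦_⟧ℤ ; +-homo = +-homoℤ ; *-homo = *-homoℤ ; -‿homo = -‿homoℤ ; 0-homo = refl ; 1-homo = refl }

  _≟ℤ_ : WeaklyDecidable (Induced-equivalence ℤ⟶R)
  i ≟ℤ j with i ℤP.≟ j
  ... | yes i≡j = just (reflexive (≡.cong ⟦_⟧ℤ i≡j))
  ... | no  _   = nothing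

  open Algebra.Solver.Ring ℤ.+-*-rawRing (fromCommutativeRing R) ℤ⟶R _≟ℤ_ public
    using (solve; _:=_; _:+_; _:*_; _:-_; :-_; con)

-- Finite permutations and the arithmetic of the exponents.

-- Pigeonhole: if `y` were missed, `punchOut` at `y` would turn `f` into an injection of `suc n`
-- elements into `n`.
injective⇒surjective : ∀ {n} (f : Fin n → Fin n) → (∀ {i j} → f i ≡ f j → i ≡ j) →
                       ∀ y → ∃ λ x → f x ≡ y
injective⇒surjective {suc n} f f-inj y with FinP.any? (λ x → f x Fin.≟ y)
... | yes found = found
... | no  missed = contradiction (FinP.injective⇒≤ punch-inj) ℕP.1+n≰n
  where
  y≢f : ∀ x → y ≢ f x
  y≢f x y≡fx = missed (x , ≡.sym y≡fx)
  punch-inj : ∀ {i j} → punchOut (y≢f i) ≡ punchOut (y≢f j) → i ≡ j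
  punch-inj {i} {j} eq = f-inj (FinP.punchOut-injective (y≢f i) (y≢f j) eq)

injective⇒permutation : ∀ {n} (f : Fin n → Fin n) → (∀ {i j} → f i ≡ f j → i ≡ j) → Permutation n n
injective⇒permutation f f-inj = permutation f (proj₁ ∘ surj) (proj₂ ∘ surj) (λ x → f-inj (proj₂ (surj (f x))))
  where surj = injective⇒surjective f f-inj

-- Prepares the exponent `e * d` with `d = gcd k q′`: for nonzero `y`, the element `y ^ (e * d)` is
-- a `d`-th power, and its `h`-th power is `y ^ q′ = 1`, where `h` also divides `p′`.
common-factor : ∀ q′ p′ k → 1 ≤ k → 3 ≤ gcd (divNat q′ (gcd k q′)) p′ →
                ∃ λ h → ∃₂ λ e f → q′ ≡ e ℕ.* gcd k q′ ℕ.* h × p′ ≡ f ℕ.* h × 3 ≤ h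
common-factor q′ p′ k 1≤k 3≤h with gcd k q′ in d-eq
... | zero   = ⊥-elim (gcd[m,n]≢0 k q′ (inj₁ (ℕP.m<n⇒n≢0 1≤k)) d-eq)
... | suc d′ with gcd[m,n]∣m (q′ / suc d′) p′ | gcd[m,n]∣n (q′ / suc d′) p′
... | divides e Q≡eh | divides f p′≡fh = h , e , f , q′≡edh , p′≡fh , 3≤h
  where
  open ≡.≡-Reasoning
  d = suc d′
  h = gcd (q′ / d) p′
  q′≡edh : q′ ≡ e ℕ.* d ℕ.* h
  q′≡edh = begin
    q′                  ≡⟨ m/n*n≡m (≡.subst (_∣ q′) d-eq (gcd[m,n]∣n k q′)) ⟨
    q′ / d ℕ.* d        ≡⟨ ≡.cong (ℕ._* d) Q≡eh ⟩
    e ℕ.* h ℕ.* d       ≡⟨ ℕP.*-assoc e h d ⟩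
    e ℕ.* (h ℕ.* d)     ≡⟨ ≡.cong (e ℕ.*_) (ℕP.*-comm h d) ⟩
    e ℕ.* (d ℕ.* h)     ≡⟨ ℕP.*-assoc e d h ⟨
    e ℕ.* d ℕ.* h       ∎

module _ {a ℓ} (M : CommutativeMonoid a ℓ) where
  open CommutativeMonoid M
  open Algebra.Properties.CommutativeMonoid.Sum M
  open Algebra.Properties.Monoid.Mult monoid using () renaming (_×_ to _·_)
  open Relation.Binary.Reasoning.Setoid setoid

  -- Translation by y permutes the family e, so both sides are the sum of the translated family.
  translation-sum : ∀ {n} (e : Fin n → Carrier) → (∀ {i j} → e i ≈ e j → i ≡ j) →
                    ∀ y → (∀ {x z} → y ∙ x ≈ y ∙ z → x ≈ z) → (∀ i → ∃ λ j → y ∙ e i ≈ e j) →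
                    (n · y) ∙ sum e ≈ sum e
  translation-sum {n} e e-inj y cancel closed = begin
    (n · y) ∙ sum e                   ≈⟨ ∙-congʳ (sum-replicate n) ⟨
    sum {n} (λ _ → y) ∙ sum e         ≈⟨ ∑-distrib-+ (λ _ → y) e ⟨
    sum (λ i → y ∙ e i)               ≈⟨ sum-cong-≋ (λ i → proj₂ (closed i)) ⟩
    sum (λ i → e (σ i))               ≈⟨ sum-permute e (injective⇒permutation σ σ-inj) ⟨
    sum e                             ∎
    where
    σ = proj₁ ∘ closed
    σ-inj : ∀ {i j} → σ i ≡ σ j → i ≡ j
    σ-inj {i} {j} eq = e-inj (cancel (trans (proj₂ (closed i)) (trans (reflexive (≡.cong e eq)) (sym (proj₂ (closed j))))))

-- Fields: roots of polynomials and the image of the naturals.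

module FieldProperties {c ℓ} (F : CommutativeRing c ℓ) (isField : IsField F) where
  open CommutativeRing F hiding (zero)
  open IntegerCoefficients F
  open Algebra.Properties.CommutativeSemiring.Exp commutativeSemiring public
  open Algebra.Properties.Group +-group using (x∙y⁻¹≈ε⇒x≈y)
  open Relation.Binary.Reasoning.Setoid setoid

  0≉1 : ¬ (0# ≈ 1#)
  0≉1 = proj₁ isField

  x-y≈0⇒x≈y : ∀ {x y} → x - y ≈ 0# → x ≈ y
  x-y≈0⇒x≈y = x∙y⁻¹≈ε⇒x≈y _ _

  x≉y⇒x-y≉0 : ∀ {x y} → ¬ (x ≈ y) → ¬ (x - y ≈ 0#)
  x≉y⇒x-y≉0 x≉y = x≉y ∘ x-y≈0⇒x≈y

  *-cancelˡ-≉0 : ∀ {x y z} → ¬ (x ≈ 0#) → x * y ≈ x * z → y ≈ z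
  *-cancelˡ-≉0 {x} {y} {z} x≉0 eq with proj₂ isField x x≉0
  ... | w , xw≈1 = begin
    y            ≈⟨ *-identityˡ y ⟨
    1# * y       ≈⟨ *-congʳ xw≈1 ⟨
    x * w * y    ≈⟨ solve 3 (λ x w y → x :* w :* y := w :* (x :* y)) refl x w y ⟩
    w * (x * y)  ≈⟨ *-congˡ eq ⟩
    w * (x * z)  ≈⟨ solve 3 (λ x w y → x :* w :* y := w :* (x :* y)) refl x w z ⟨
    x * w * z    ≈⟨ *-congʳ xw≈1 ⟩
    1# * z       ≈⟨ *-identityˡ z ⟩
    z            ∎

  x*y≈0⇒y≈0 : ∀ {x y} → ¬ (x ≈ 0#) → x * y ≈ 0# → y ≈ 0#
  x*y≈0⇒y≈0 x≉0 xy≈0 = *-cancelˡ-≉0 x≉0 (trans xy≈0 (sym (zeroʳ _)))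

  *-≉0 : ∀ {x y} → ¬ (x ≈ 0#) → ¬ (y ≈ 0#) → ¬ (x * y ≈ 0#)
  *-≉0 x≉0 y≉0 = y≉0 ∘ x*y≈0⇒y≈0 x≉0

  ^-≉0 : ∀ {x} n → ¬ (x ≈ 0#) → ¬ (x ^ n ≈ 0#)
  ^-≉0 zero    x≉0 = 0≉1 ∘ sym
  ^-≉0 (suc n) x≉0 = *-≉0 x≉0 (^-≉0 n x≉0)

  1^n≈1 : ∀ n → 1# ^ n ≈ 1#
  1^n≈1 zero    = refl
  1^n≈1 (suc n) = trans (*-identityˡ _) (1^n≈1 n)

  -- Polynomial functions in Horner form: `a` is the constant term, and the degree is the recursion
  -- argument.
  MonicFunction : ℕ → (Carrier → Carrier) → Set (c ⊔ ℓ)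
  MonicFunction zero    φ = ∀ x → φ x ≈ 1#
  MonicFunction (suc n) φ = ∃₂ λ a ψ → MonicFunction n ψ × (∀ x → φ x ≈ a + x * ψ x)

  -- Division by `x - r` with the value at `r` as remainder. From `ψ x = ψ r + (x - r) * χ x`, the
  -- quotient for `a + x * ψ x` is `ψ r + x * χ x`.
  factor-at : ∀ n {φ} → MonicFunction (suc n) φ → ∀ r →
              ∃ λ ψ → MonicFunction n ψ × (∀ x → φ x ≈ φ r + (x - r) * ψ x)
  factor-at zero {φ} (a , ψ , ψ≈1 , φ≈) r = ψ , ψ≈1 , λ x → begin
    φ x                          ≈⟨ φ≈ x ⟩
    a + x * ψ x                  ≈⟨ +-congˡ (*-congˡ (ψ≈1 x)) ⟩
    a + x * 1#                   ≈⟨ solve 3 (λ a x r → a :+ x :* con (+ 1) := a :+ r :* con (+ 1) :+ (x :- r) :* con (+ 1)) refl a x r ⟩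
    a + r * 1# + (x - r) * 1#    ≈⟨ +-cong (+-congˡ (*-congˡ (ψ≈1 r))) (*-congˡ (ψ≈1 x)) ⟨
    a + r * ψ r + (x - r) * ψ x  ≈⟨ +-congʳ (φ≈ r) ⟨
    φ r + (x - r) * ψ x          ∎
  factor-at (suc n) {φ} (a , ψ , ψ-monic , φ≈) r with factor-at n ψ-monic r
  ... | χ , χ-monic , ψ≈ = (λ x → ψ r + x * χ x) , (ψ r , χ , χ-monic , λ _ → refl) , λ x → begin
    φ x                                      ≈⟨ φ≈ x ⟩
    a + x * ψ x                              ≈⟨ +-congˡ (*-congˡ (ψ≈ x)) ⟩
    a + x * (ψ r + (x - r) * χ x)            ≈⟨ solve 5 (λ a x r s t → a :+ x :* (s :+ (x :- r) :* t) := a :+ r :* s :+ (x :- r) :* (s :+ x :* t)) refl a x r (ψ r) (χ x) ⟩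
    a + r * ψ r + (x - r) * (ψ r + x * χ x)  ≈⟨ +-congʳ (φ≈ r) ⟨
    φ r + (x - r) * (ψ r + x * χ x)          ∎

  -- After splitting off `x - r zero`, the other points are roots of the quotient because they
  -- differ from `r zero`.
  too-many-roots : ∀ n {φ} → MonicFunction n φ → (r : Fin (suc n) → Carrier) →
                   (∀ {i j} → r i ≈ r j → i ≡ j) → ¬ (∀ i → φ (r i) ≈ 0#)
  too-many-roots zero    φ≈1 r r-inj roots = 0≉1 (trans (sym (roots zero)) (φ≈1 (r zero)))
  too-many-roots (suc n) {φ} φ-monic r r-inj roots with factor-at n φ-monic (r zero)
  ... | ψ , ψ-monic , φ≈ = too-many-roots n ψ-monic (r ∘ suc) (FinP.suc-injective ∘ r-inj) λ i →
    x*y≈0⇒y≈0 (x≉y⇒x-y≉0 (λ eq → FinP.0≢1+n (≡.sym (r-inj eq)))) (begin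
      (r (suc i) - r zero) * ψ (r (suc i))               ≈⟨ +-identityˡ _ ⟨
      0# + (r (suc i) - r zero) * ψ (r (suc i))          ≈⟨ +-congʳ (roots zero) ⟨
      φ (r zero) + (r (suc i) - r zero) * ψ (r (suc i))  ≈⟨ φ≈ (r (suc i)) ⟨
      φ (r (suc i))                                      ≈⟨ roots (suc i) ⟩
      0#                                                 ∎)

  ^-monic : ∀ n → MonicFunction n (_^ n)
  ^-monic zero    = λ _ → refl
  ^-monic (suc n) = 0# , (_^ n) , ^-monic n , λ x → sym (+-identityˡ _)

  too-many-roots-of-unity : ∀ n .{{_ : NonZero n}} (r : Fin (suc n) → Carrier) →
                            (∀ {i j} → r i ≈ r j → i ≡ j) → ¬ (∀ i → r i ^ n ≈ 1#)
  too-many-roots-of-unity (suc n) r r-inj roots =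
    too-many-roots (suc n) {λ x → - 1# + x ^ suc n} (- 1# , (_^ n) , ^-monic n , λ _ → refl) r r-inj
      (λ i → trans (+-congˡ (roots i)) (-‿inverseˡ 1#))

  -- Multiplication by `y` permutes the family, so `y ^ n` times its product is the same product,
  -- which can be cancelled. Applied to the units of the whole field and to those of the prime
  -- field.
  orbit-power≈1 : ∀ {n} (e : Fin n → Carrier) → (∀ {i j} → e i ≈ e j → i ≡ j) → (∀ i → ¬ (e i ≈ 0#)) →
                  ∀ {y} → ¬ (y ≈ 0#) → (∀ i → ∃ λ j → y * e i ≈ e j) → y ^ n ≈ 1#
  orbit-power≈1 {n} e e-inj e≉0 {y} y≉0 closed = *-cancelˡ-≉0 (prod≉0 e e≉0) (begin
    product e * y ^ n  ≈⟨ *-comm _ _ ⟩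
    y ^ n * product e  ≈⟨ translation-sum *-commutativeMonoid e e-inj y (*-cancelˡ-≉0 y≉0) closed ⟩
    product e          ≈⟨ *-identityʳ _ ⟨
    product e * 1#     ∎)
    where
    open Algebra.Properties.CommutativeMonoid.Sum *-commutativeMonoid using () renaming (sum to product)
    prod≉0 : ∀ {n} (e : Fin n → Carrier) → (∀ i → ¬ (e i ≈ 0#)) → ¬ (product e ≈ 0#)
    prod≉0 {zero}  e e≉0 = 0≉1 ∘ sym
    prod≉0 {suc n} e e≉0 = *-≉0 (e≉0 zero) (prod≉0 (e ∘ suc) (e≉0 ∘ suc))

  ι : ℕ → Carrier
  ι = fromℕ F

  ι-+ : ∀ m n → ι (m ℕ.+ n) ≈ ι m + ι n
  ι-+ zero    n = sym (+-identityˡ _)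
  ι-+ (suc m) n = trans (+-congˡ (ι-+ m n)) (sym (+-assoc _ _ _))

  ι-* : ∀ m n → ι (m ℕ.* n) ≈ ι m * ι n
  ι-* zero    n = sym (zeroˡ _)
  ι-* (suc m) n = begin
    ι (n ℕ.+ m ℕ.* n)     ≈⟨ ι-+ n (m ℕ.* n) ⟩
    ι n + ι (m ℕ.* n)     ≈⟨ +-congˡ (ι-* m n) ⟩
    ι n + ι m * ι n       ≈⟨ solve 2 (λ m n → n :+ m :* n := (con (+ 1) :+ m) :* n) refl (ι m) (ι n) ⟩
    (1# + ι m) * ι n      ∎

  ι-^ : ∀ m n → ι (m ℕ.^ n) ≈ ι m ^ n
  ι-^ m zero    = +-identityʳ 1#
  ι-^ m (suc n) = trans (ι-* m (m ℕ.^ n)) (*-congˡ (ι-^ m n))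

-- The finite field and its prime subfield.

module FiniteField {c ℓ} (F : CommutativeRing c ℓ) (isField : IsField F) (q′ : ℕ) (card : HasCard F (suc q′)) where
  open CommutativeRing F hiding (zero)
  open FieldProperties F isField
  open Algebra.Properties.Group +-group using (identityˡ-unique; ∙-cancelˡ)
  open Relation.Binary.Reasoning.Setoid setoid
  open Inverse card using () renaming (to to index; from to element; to-cong to index-cong; from-cong to element-cong; strictlyInverseˡ to index-element; strictlyInverseʳ to element-index)

  index-injective : ∀ {x y} → index x ≡ index y → x ≈ y
  index-injective {x} {y} eq = trans (sym (element-index x)) (trans (element-cong eq) (element-index y))

  element-injective : ∀ {i j} → element i ≈ element j → i ≡ j
  element-injective {i} {j} eq = ≡.trans (≡.sym (index-element i)) (≡.trans (index-cong eq) (index-element j))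

  infix 4 _≈?_
  _≈?_ : ∀ x y → Dec (x ≈ y)
  x ≈? y = map′ index-injective index-cong (index x Fin.≟ index y)

  nonzero : Fin q′ → Carrier
  nonzero i = element (punchIn (index 0#) i)

  nonzero-injective : ∀ {i j} → nonzero i ≈ nonzero j → i ≡ j
  nonzero-injective = FinP.punchIn-injective (index 0#) _ _ ∘ element-injective

  nonzero≉0 : ∀ i → ¬ (nonzero i ≈ 0#)
  nonzero≉0 i eq = FinP.punchInᵢ≢i (index 0#) i (≡.trans (≡.sym (index-element _)) (index-cong eq))

  nonzero-surjective : ∀ {x} → ¬ (x ≈ 0#) → ∃ λ i → x ≈ nonzero i
  nonzero-surjective {x} x≉0 = punchOut 0≢x , sym (trans (element-cong (FinP.punchIn-punchOut 0≢x)) (element-index x))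
    where
    0≢x : index 0# ≢ index x
    0≢x eq = x≉0 (sym (index-injective eq))

  x^q′≈1 : ∀ {x} → ¬ (x ≈ 0#) → x ^ q′ ≈ 1#
  x^q′≈1 x≉0 = orbit-power≈1 nonzero nonzero-injective nonzero≉0 x≉0
    (λ i → nonzero-surjective (*-≉0 x≉0 (nonzero≉0 i)))

  -- Adding `1#` permutes the field, so the sum of all elements absorbs `suc q′` copies of `1#`.
  ι-card : ι (suc q′) ≈ 0#
  ι-card = trans (ι≈× (suc q′)) (identityˡ-unique _ _
    (translation-sum +-commutativeMonoid element element-injective 1# (λ {x} {z} → ∙-cancelˡ 1# x z)
      (λ i → index (1# + element i) , sym (element-index _))))
    where
    open Algebra.Properties.Monoid.Mult +-monoid using () renaming (_×_ to _·_)
    ι≈× : ∀ n → ι n ≈ n · 1#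
    ι≈× zero    = refl
    ι≈× (suc n) = +-congˡ (ι≈× n)

  -- Since `x ^ q′` is `1#`, Bézout turns the gcd into a multiple of `k` in the exponent. When the
  -- coefficient of `k` is negative, the root is the inverse of a power of `x`.
  gcd-power-is-power : ∀ k {x} → ¬ (x ≈ 0#) → ∃ λ z → z ^ k ≈ x ^ gcd k q′
  gcd-power-is-power k {x} x≉0 with Bézout.identity (gcd-GCD k q′)
  ... | Bézout.+- u v eq = x ^ u , (begin
    (x ^ u) ^ k                      ≈⟨ ^-assocʳ x u k ⟩
    x ^ (u ℕ.* k)                    ≈⟨ ^-congʳ x eq ⟨
    x ^ (gcd k q′ ℕ.+ v ℕ.* q′)      ≈⟨ ^-homo-* x (gcd k q′) (v ℕ.* q′) ⟩
    x ^ gcd k q′ * x ^ (v ℕ.* q′)    ≈⟨ *-congˡ (x^vq′≈1 v) ⟩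
    x ^ gcd k q′ * 1#                ≈⟨ *-identityʳ _ ⟩
    x ^ gcd k q′                     ∎)
    where
    x^vq′≈1 : ∀ v → x ^ (v ℕ.* q′) ≈ 1#
    x^vq′≈1 v = trans (^-congʳ x (ℕP.*-comm v q′)) (trans (sym (^-assocʳ x q′ v)) (trans (^-congˡ v (x^q′≈1 x≉0)) (1^n≈1 v)))
  ... | Bézout.-+ u v eq with proj₂ isField (x ^ u) (^-≉0 u x≉0)
  ... | w , x^u*w≈1 = w , (begin
    w ^ k                                     ≈⟨ *-identityˡ _ ⟨
    1# * w ^ k                                ≈⟨ *-congʳ 1≈ ⟩
    x ^ gcd k q′ * (x ^ u) ^ k * w ^ k        ≈⟨ *-assoc _ _ _ ⟩
    x ^ gcd k q′ * ((x ^ u) ^ k * w ^ k)      ≈⟨ *-congˡ (^-distrib-* (x ^ u) w k) ⟨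
    x ^ gcd k q′ * (x ^ u * w) ^ k            ≈⟨ *-congˡ (trans (^-congˡ k x^u*w≈1) (1^n≈1 k)) ⟩
    x ^ gcd k q′ * 1#                         ≈⟨ *-identityʳ _ ⟩
    x ^ gcd k q′                              ∎)
    where
    1≈ : 1# ≈ x ^ gcd k q′ * (x ^ u) ^ k
    1≈ = begin
      1#                              ≈⟨ 1^n≈1 v ⟨
      1# ^ v                          ≈⟨ ^-congˡ v (x^q′≈1 x≉0) ⟨
      (x ^ q′) ^ v                    ≈⟨ ^-assocʳ x q′ v ⟩
      x ^ (q′ ℕ.* v)                  ≈⟨ ^-congʳ x (≡.trans (ℕP.*-comm q′ v) (≡.sym eq)) ⟩
      x ^ (gcd k q′ ℕ.+ u ℕ.* k)      ≈⟨ ^-homo-* x (gcd k q′) (u ℕ.* k) ⟩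
      x ^ gcd k q′ * x ^ (u ℕ.* k)    ≈⟨ *-congˡ (^-assocʳ x u k) ⟨
      x ^ gcd k q′ * (x ^ u) ^ k      ∎

  -- There are `q′` nonzero elements, more than `x ^ n - 1` has roots.
  element-with-power≉1 : ∀ n .{{_ : NonZero n}} → n < q′ → ∃ λ x → ¬ (x ≈ 0#) × ¬ (x ^ n ≈ 1#)
  element-with-power≉1 n n<q′ with FinP.any? (λ i → ¬? (nonzero i ^ n ≈? 1#))
  ... | yes (i , xⁿ≉1) = nonzero i , nonzero≉0 i , xⁿ≉1
  ... | no  none = ⊥-elim (too-many-roots-of-unity n (λ i → nonzero (inject≤ i n<q′))
    (FinP.inject≤-injective n<q′ n<q′ _ _ ∘ nonzero-injective)
    (λ i → decidable-stable (_ ≈? _) (λ xⁿ≉1 → none (_ , xⁿ≉1))))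

  module Characteristic (p′ : ℕ) (p-prime : Prime (suc p′)) (p≈0 : ι (suc p′) ≈ 0#) where

    p : ℕ
    p = suc p′

    ι-% : ∀ m → ι (m % p) ≈ ι m
    ι-% m = sym (begin
      ι m                               ≡⟨ ≡.cong ι (m≡m%n+[m/n]*n m p) ⟩
      ι (m % p ℕ.+ m / p ℕ.* p)         ≈⟨ ι-+ (m % p) (m / p ℕ.* p) ⟩
      ι (m % p) + ι (m / p ℕ.* p)       ≈⟨ +-congˡ (trans (ι-* (m / p) p) (trans (*-congˡ p≈0) (zeroʳ _))) ⟩
      ι (m % p) + 0#                    ≈⟨ +-identityʳ _ ⟩
      ι (m % p)                         ∎)

    multiple : ∀ u {x} → ι x ≈ 0# → ι (u ℕ.* x) ≈ 0#
    multiple u {x} x≈0 = trans (ι-* u x) (trans (*-congˡ x≈0) (zeroʳ _))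

    -- Were `suc m` zero in the field, Bézout for the coprime pair `p`, `suc m` would make `1#` zero
    -- as well.
    ι≉0 : ∀ m → suc m < p → ¬ (ι (suc m) ≈ 0#)
    ι≉0 m m<p m≈0 with coprime-Bézout (prime⇒coprime p-prime m<p)
    ... | Bézout.+- u v eq = 0≉1 (begin
      0#                        ≈⟨ multiple u p≈0 ⟨
      ι (u ℕ.* p)               ≡⟨ ≡.cong ι eq ⟨
      1# + ι (v ℕ.* suc m)      ≈⟨ +-congˡ (multiple v m≈0) ⟩
      1# + 0#                   ≈⟨ +-identityʳ 1# ⟩
      1#                        ∎)
    ... | Bézout.-+ u v eq = 0≉1 (begin
      0#                        ≈⟨ multiple v m≈0 ⟨
      ι (v ℕ.* suc m)           ≡⟨ ≡.cong ι eq ⟨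
      1# + ι (u ℕ.* p)          ≈⟨ +-congˡ (multiple u p≈0) ⟩
      1# + 0#                   ≈⟨ +-identityʳ 1# ⟩
      1#                        ∎)

    ι-<-≉ : ∀ {i j} → i < j → j < p → ¬ (ι i ≈ ι j)
    ι-<-≉ {i} {suc j} (s≤s i≤j) j<p eq = ι≉0 (j ∸ i) (ℕP.≤-<-trans (s≤s (ℕP.m∸n≤m j i)) j<p)
      (sym (∙-cancelˡ (ι i) _ _ (begin
        ι i + 0#                 ≈⟨ +-identityʳ _ ⟩
        ι i                      ≈⟨ eq ⟩
        ι (suc j)                ≡⟨ ≡.cong ι (≡.trans (≡.cong suc (≡.sym (ℕP.m+[n∸m]≡n i≤j))) (≡.sym (ℕP.+-suc i (j ∸ i)))) ⟩
        ι (i ℕ.+ suc (j ∸ i))    ≈⟨ ι-+ i (suc (j ∸ i)) ⟩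
        ι i + ι (suc (j ∸ i))    ∎)))

    ι-injective : ∀ {i j} → i < p → j < p → ι i ≈ ι j → i ≡ j
    ι-injective {i} {j} i<p j<p eq with ℕP.<-cmp i j
    ... | tri< i<j _ _ = ⊥-elim (ι-<-≉ i<j j<p eq)
    ... | tri≈ _ i≡j _ = i≡j
    ... | tri> _ _ j<i = ⊥-elim (ι-<-≉ j<i i<p (sym eq))

    unit : Fin p′ → Carrier
    unit i = ι (suc (toℕ i))

    unit-injective : ∀ {i j} → unit i ≈ unit j → i ≡ j
    unit-injective {i} {j} = FinP.toℕ-injective ∘ ℕP.suc-injective ∘ ι-injective (s≤s (FinP.toℕ<n i)) (s≤s (FinP.toℕ<n j))

    unit≉0 : ∀ i → ¬ (unit i ≈ 0#)
    unit≉0 i = ι≉0 (toℕ i) (s≤s (FinP.toℕ<n i))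

    unit-surjective : ∀ m → ¬ (ι m ≈ 0#) → ∃ λ i → ι m ≈ unit i
    unit-surjective m m≉0 with m % p | ι-% m | m%n<n m p
    ... | zero  | 0≈m | _ = ⊥-elim (m≉0 (sym 0≈m))
    ... | suc r | r≈m | s≤s r<p′ = fromℕ< r<p′ , trans (sym r≈m) (reflexive (≡.cong (ι ∘ suc) (≡.sym (FinP.toℕ-fromℕ< r<p′))))

    unit^p′≈1 : ∀ i → unit i ^ p′ ≈ 1#
    unit^p′≈1 i = orbit-power≈1 unit unit-injective unit≉0 (unit≉0 i) (λ j →
      let uv≈ = ι-* (suc (toℕ i)) (suc (toℕ j))
          (l , eq) = unit-surjective (suc (toℕ i) ℕ.* suc (toℕ j)) (*-≉0 (unit≉0 i) (unit≉0 j) ∘ trans (sym uv≈))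
      in l , trans (sym uv≈) eq)

    -- The `p′` units of the prime field are already roots of `x ^ p′ - 1`; a root outside them
    -- would be one too many.
    x^p′≈1⇒InPrimeSubfield : .{{_ : NonZero p′}} → ∀ {x} → x ^ p′ ≈ 1# → InPrimeSubfield F x
    x^p′≈1⇒InPrimeSubfield {x} xᵖ≈1 with FinP.any? (λ i → x ≈? unit i)
    ... | yes (i , eq) = suc (toℕ i) , eq
    ... | no  none = ⊥-elim (too-many-roots-of-unity p′ r r-inj r-root)
      where
      r : Fin (suc p′) → Carrier
      r zero    = x
      r (suc i) = unit i
      r-inj : ∀ {i j} → r i ≈ r j → i ≡ j
      r-inj {zero}  {zero}  _  = ≡.refl
      r-inj {zero}  {suc j} eq = ⊥-elim (none (j , eq))
      r-inj {suc i} {zero}  eq = ⊥-elim (none (i , sym eq))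
      r-inj {suc i} {suc j} eq = ≡.cong suc (unit-injective eq)
      r-root : ∀ i → r i ^ p′ ≈ 1#
      r-root zero    = xᵖ≈1
      r-root (suc i) = unit^p′≈1 i

    -- `p′` stands for -1 modulo `p`, so `m + p′ * s` represents `t - x`; reduction modulo `p` gives
    -- `j ≤ p′`.
    solve-ι : ∀ {x t} → InPrimeSubfield F x → InPrimeSubfield F t → ∃ λ j → j ≤ p′ × ι j + x ≈ t
    solve-ι {x} {t} (s , x≈s) (m , t≈m) = (m ℕ.+ p′ ℕ.* s) % p , ℕP.≤-pred (m%n<n (m ℕ.+ p′ ℕ.* s) p) , (begin
      ι ((m ℕ.+ p′ ℕ.* s) % p) + x     ≈⟨ +-cong (ι-% (m ℕ.+ p′ ℕ.* s)) x≈s ⟩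
      ι (m ℕ.+ p′ ℕ.* s) + ι s         ≈⟨ ι-+ (m ℕ.+ p′ ℕ.* s) s ⟨
      ι (m ℕ.+ p′ ℕ.* s ℕ.+ s)         ≡⟨ ≡.cong ι (≡.trans (ℕP.+-assoc m _ s) (≡.cong (m ℕ.+_) (ℕP.+-comm (p′ ℕ.* s) s))) ⟩
      ι (m ℕ.+ p ℕ.* s)                ≈⟨ ι-+ m (p ℕ.* s) ⟩
      ι m + ι (p ℕ.* s)                ≈⟨ +-congˡ (trans (ι-* p s) (trans (*-congʳ p≈0) (zeroˡ _))) ⟩
      ι m + 0#                         ≈⟨ +-identityʳ _ ⟩
      ι m                              ≈⟨ t≈m ⟨
      t                                ∎)

    power-in-prime-subfield : .{{_ : NonZero q′}} → .{{_ : NonZero p′}} → ∀ k → 1 ≤ k → 3 ≤ gcd (divNat q′ (gcd k q′)) p′ →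
      ∃₂ λ ω z → z ^ k ≈ ω × InPrimeSubfield F ω × ¬ (ω ≈ 0#) × ¬ (ω * ω ≈ 1#)
    power-in-prime-subfield k 1≤k 3≤gcd with common-factor q′ p′ k 1≤k 3≤gcd
    ... | h , e , f , q′≡edh , p′≡fh , 3≤h = ω , z , zᵏ≈ω , ω∈Fp , ω≉0 , ω²≉1
      where
      d = gcd k q′
      ed≢0 : NonZero (e ℕ.* d)
      ed≢0 = ℕP.m*n≢0⇒m≢0 (e ℕ.* d) {{≡.subst NonZero q′≡edh it}}
        where it : NonZero q′
              it = ℕ.>-nonZero (ℕP.n≢0⇒n>0 (ℕ.≢-nonZero⁻¹ q′))
      instance
        ed2≢0 : NonZero (e ℕ.* d ℕ.* 2)
        ed2≢0 = ℕP.m*n≢0 (e ℕ.* d) 2 {{ed≢0}}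
      ed2<q′ : e ℕ.* d ℕ.* 2 < q′
      -- `3≤h` reads `2 < h`, so the exponent `e * d * 2` lies below `e * d * h = q′`, which leaves
      -- room for a `y` with `ω * ω ≉ 1#`.
      ed2<q′ = ≡.subst (e ℕ.* d ℕ.* 2 <_) (≡.sym q′≡edh) (ℕP.*-monoʳ-< (e ℕ.* d) {{ed≢0}} 3≤h)
      found = element-with-power≉1 (e ℕ.* d ℕ.* 2) ed2<q′
      y = proj₁ found
      y≉0 = proj₁ (proj₂ found)
      ω = y ^ (e ℕ.* d)
      ω≉0 : ¬ (ω ≈ 0#)
      ω≉0 = ^-≉0 (e ℕ.* d) y≉0
      ω²≉1 : ¬ (ω * ω ≈ 1#)
      ω²≉1 eq = proj₂ (proj₂ found) (trans (sym (^-assocʳ y (e ℕ.* d) 2)) (trans (*-congˡ (*-identityʳ ω)) eq))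
      root = gcd-power-is-power k (^-≉0 e y≉0)
      z = proj₁ root
      zᵏ≈ω : z ^ k ≈ ω
      zᵏ≈ω = trans (proj₂ root) (^-assocʳ y e d)
      ωʰ≈1 : ω ^ h ≈ 1#
      ωʰ≈1 = trans (^-assocʳ y (e ℕ.* d) h) (trans (^-congʳ y (≡.sym q′≡edh)) (x^q′≈1 y≉0))
      ω∈Fp : InPrimeSubfield F ω
      ω∈Fp = x^p′≈1⇒InPrimeSubfield (begin
        ω ^ p′           ≈⟨ ^-congʳ ω (≡.trans p′≡fh (ℕP.*-comm f h)) ⟩
        ω ^ (h ℕ.* f)    ≈⟨ ^-assocʳ ω h f ⟨
        (ω ^ h) ^ f      ≈⟨ trans (^-congˡ f ωʰ≈1) (1^n≈1 f) ⟩
        1#               ∎)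

-- Classical reasoning under a double negation.

¬¬-em : ∀ {a} (A : Set a) → ¬ ¬ (A ⊎ ¬ A)
¬¬-em A k = k (inj₂ (k ∘ inj₁))

-- Descent along `<`: a witness that is not least has a smaller one. Nothing decides `P`, hence the
-- double negation.
least : ∀ {a} (P : ℕ → Set a) n → P n → ¬ ¬ (∃ λ m → m ≤ n × P m × (∀ i → i < m → ¬ P i))
least P = <-rec _ step
  where
  step : ∀ n → (∀ {m} → m < n → P m → ¬ ¬ (∃ λ l → l ≤ m × P l × (∀ i → i < l → ¬ P i))) →
         P n → ¬ ¬ (∃ λ m → m ≤ n × P m × (∀ i → i < m → ¬ P i))
  step n smaller pn k = k (n , ℕP.≤-refl , pn , λ i i<n pi →
    smaller i<n pi λ (m , m≤i , pm , below) → k (m , ℕP.≤-trans m≤i (ℕP.<⇒≤ i<n) , pm , below))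

-- Vectors and linear operators.

module Vectors {c ℓ} (F : CommutativeRing c ℓ) (n : ℕ) where
  open CommutativeRing F hiding (zero)

  V : Set c
  V = Fin n → Carrier

  infix 4 _≋_ _≗ᵒ_
  infixl 6 _⊕_
  infixr 7 _·_

  _≋_ : V → V → Set ℓ
  v ≋ w = ∀ i → v i ≈ w i

  _⊕_ : V → V → V
  (v ⊕ w) i = v i + w i

  _·_ : Carrier → V → V
  (a · v) i = a * v i

  𝟘 : V
  𝟘 i = 0#

  V-setoid : Setoid c ℓ
  V-setoid = record { Carrier = V ; _≈_ = _≋_ ; isEquivalence = record
    { refl = λ i → refl ; sym = λ p i → sym (p i) ; trans = λ p q i → trans (p i) (q i) } }

  open Setoid V-setoid public using () renaming (refl to ≋-refl; sym to ≋-sym; trans to ≋-trans)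

  ⊕-cong : ∀ {v v′ w w′} → v ≋ v′ → w ≋ w′ → v ⊕ w ≋ v′ ⊕ w′
  ⊕-cong p q i = +-cong (p i) (q i)

  ·-cong : ∀ {a b v w} → a ≈ b → v ≋ w → a · v ≋ b · w
  ·-cong p q i = *-cong p (q i)

  ·-𝟘 : ∀ a → a · 𝟘 ≋ 𝟘
  ·-𝟘 a i = zeroʳ a

  0·v : ∀ {a} v → a ≈ 0# → a · v ≋ 𝟘
  0·v v a≈0 i = trans (*-congʳ a≈0) (zeroˡ _)

  ⊕-identityʳ : ∀ {v w} → w ≋ 𝟘 → v ⊕ w ≋ v
  ⊕-identityʳ p i = trans (+-congˡ (p i)) (+-identityʳ _)

  ⊕-identityˡ : ∀ {v w} → v ≋ 𝟘 → v ⊕ w ≋ w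
  ⊕-identityˡ p i = trans (+-congʳ (p i)) (+-identityˡ _)

  Op : Set c
  Op = V → V

  _≗ᵒ_ : Op → Op → Set (c ⊔ ℓ)
  φ ≗ᵒ ψ = ∀ v → φ v ≋ ψ v

  record Linear (φ : Op) : Set (c ⊔ ℓ) where
    field
      cong : ∀ {v w} → v ≋ w → φ v ≋ φ w
      +-hom : ∀ v w → φ (v ⊕ w) ≋ φ v ⊕ φ w
      ·-hom : ∀ a v → φ (a · v) ≋ a · φ v

    0-hom : ∀ {v} → v ≋ 𝟘 → φ v ≋ 𝟘
    0-hom {v} v≋0 = begin
      φ v           ≈⟨ cong (λ i → trans (v≋0 i) (sym (zeroˡ _))) ⟩
      φ (0# · v)    ≈⟨ ·-hom 0# v ⟩
      0# · φ v      ≈⟨ 0·v (φ v) refl ⟩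
      𝟘             ∎
      where open Relation.Binary.Reasoning.Setoid V-setoid

-- Polynomials in an operator and the existence of a cyclic vector.

module PolynomialOperators {c ℓ} (F : CommutativeRing c ℓ) (isField : IsField F)
  (_≈?_ : ∀ x y → Dec (CommutativeRing._≈_ F x y)) (n : ℕ)
  (T : Vectors.Op F n) (T-linear : Vectors.Linear F n T) where
  open CommutativeRing F hiding (zero)
  open Vectors F n
  open IntegerCoefficients F
  open Relation.Binary.Reasoning.Setoid V-setoid
  private module T = Linear T-linear

  infixr 8 T^_
  T^_ : ℕ → Op
  (T^ zero)  v = v
  (T^ suc j) v = T ((T^ j) v)

  T^-+ : ∀ i j v → (T^ (i ℕ.+ j)) v ≋ (T^ i) ((T^ j) v)
  T^-+ zero    j v = ≋-refl
  T^-+ (suc i) j v = T.cong (T^-+ i j v)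

  -- Deg< j φ and Monicᵒ j φ say that φ is f(T) for a polynomial f of degree < j, resp. monic of degree j.
  Deg< : ℕ → Op → Set (c ⊔ ℓ)
  Deg< zero    φ = ∀ v → φ v ≋ 𝟘
  Deg< (suc j) φ = ∃₂ λ a ψ → Deg< j ψ × (∀ v → φ v ≋ ψ v ⊕ a · (T^ j) v)

  Monicᵒ : ℕ → Op → Set (c ⊔ ℓ)
  Monicᵒ j φ = ∃ λ ψ → Deg< j ψ × (∀ v → φ v ≋ ψ v ⊕ (T^ j) v)

  Deg<-resp : ∀ j {φ ψ} → φ ≗ᵒ ψ → Deg< j φ → Deg< j ψ
  Deg<-resp zero    eq φ≋0 v = ≋-trans (≋-sym (eq v)) (φ≋0 v)
  Deg<-resp (suc j) eq (a , χ , χ-low , φ≋) = a , χ , χ-low , λ v → ≋-trans (≋-sym (eq v)) (φ≋ v)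

  Deg<-suc : ∀ j {φ} → Deg< j φ → Deg< (suc j) φ
  Deg<-suc j {φ} low = 0# , φ , low , λ v → ≋-sym (⊕-identityʳ (0·v _ refl))

  Deg<-weaken : ∀ i j {φ} → Deg< j φ → Deg< (i ℕ.+ j) φ
  Deg<-weaken zero    j low = low
  Deg<-weaken (suc i) j low = Deg<-suc (i ℕ.+ j) (Deg<-weaken i j low)

  Deg<-𝟘 : ∀ j → Deg< j (λ _ → 𝟘)
  Deg<-𝟘 zero    = λ _ → ≋-refl
  Deg<-𝟘 (suc j) = Deg<-suc j (Deg<-𝟘 j)

  Deg<-⊕ : ∀ j {φ ψ} → Deg< j φ → Deg< j ψ → Deg< j (λ v → φ v ⊕ ψ v)
  Deg<-⊕ zero    φ≋0 ψ≋0 v = ≋-trans (⊕-identityʳ (ψ≋0 v)) (φ≋0 v)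
  Deg<-⊕ (suc j) (a , φ′ , φ′-low , φ≋) (b , ψ′ , ψ′-low , ψ≋) =
    a + b , _ , Deg<-⊕ j φ′-low ψ′-low , λ v → ≋-trans (⊕-cong (φ≋ v) (ψ≋ v)) λ i →
      solve 5 (λ a b x y t → (x :+ a :* t) :+ (y :+ b :* t) := (x :+ y) :+ (a :+ b) :* t) refl a b (φ′ v i) (ψ′ v i) ((T^ j) v i)

  Deg<-· : ∀ j b {φ} → Deg< j φ → Deg< j (λ v → b · φ v)
  Deg<-· zero    b φ≋0 v = ≋-trans (·-cong refl (φ≋0 v)) (·-𝟘 b)
  Deg<-· (suc j) b (a , φ′ , φ′-low , φ≋) =
    b * a , _ , Deg<-· j b φ′-low , λ v → ≋-trans (·-cong refl (φ≋ v)) λ i →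
      solve 4 (λ a b x t → b :* (x :+ a :* t) := b :* x :+ (b :* a) :* t) refl a b (φ′ v i) ((T^ j) v i)

  Deg<-T : ∀ j {φ} → Deg< j φ → Deg< (suc j) (T ∘ φ)
  Deg<-T zero    φ≋0 = Deg<-suc zero (λ v → T.0-hom (φ≋0 v))
  Deg<-T (suc j) {φ} (a , φ′ , φ′-low , φ≋) = a , _ , Deg<-T j φ′-low , λ v → begin
    T (φ v)                            ≈⟨ T.cong (φ≋ v) ⟩
    T (φ′ v ⊕ a · (T^ j) v)            ≈⟨ T.+-hom _ _ ⟩
    T (φ′ v) ⊕ T (a · (T^ j) v)        ≈⟨ ⊕-cong ≋-refl (T.·-hom a _) ⟩
    T (φ′ v) ⊕ a · T ((T^ j) v)        ∎

  Deg<-T^ : ∀ i j {φ} → Deg< j φ → Deg< (i ℕ.+ j) ((T^ i) ∘ φ)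
  Deg<-T^ zero    j low = low
  Deg<-T^ (suc i) j low = Deg<-T (i ℕ.+ j) (Deg<-T^ i j low)

  T^-low : ∀ j → Deg< (suc j) (T^ j)
  T^-low j = 1# , _ , Deg<-𝟘 j , λ v i → solve 1 (λ t → t := con (+ 0) :+ con (+ 1) :* t) refl ((T^ j) v i)

  -- The sharp bound would be `i + j - 1`; the slack avoids truncated subtraction.
  Deg<-∘ : ∀ i j {φ ψ} → Deg< i φ → Deg< j ψ → Deg< (i ℕ.+ j) (φ ∘ ψ)
  Deg<-∘ zero    j {φ} {ψ} φ≋0 _ = Deg<-resp j (λ v → ≋-sym (φ≋0 (ψ v))) (Deg<-𝟘 j)
  Deg<-∘ (suc i) j {φ} {ψ} (a , φ′ , φ′-low , φ≋) ψ-low =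
    Deg<-resp (suc i ℕ.+ j) (λ v → ≋-sym (φ≋ (ψ v))) (Deg<-suc (i ℕ.+ j)
      (Deg<-⊕ (i ℕ.+ j) (Deg<-∘ i j φ′-low ψ-low) (Deg<-· (i ℕ.+ j) a (Deg<-T^ i j ψ-low))))

  T^-linear : ∀ j → Linear (T^ j)
  T^-linear zero = record { cong = id ; +-hom = λ _ _ → ≋-refl ; ·-hom = λ _ _ → ≋-refl }
  T^-linear (suc j) = record
    { cong  = T.cong ∘ L.cong
    ; +-hom = λ v w → ≋-trans (T.cong (L.+-hom v w)) (T.+-hom _ _)
    ; ·-hom = λ a v → ≋-trans (T.cong (L.·-hom a v)) (T.·-hom a _) }
    where module L = Linear (T^-linear j)

  Deg<-linear : ∀ j {φ} → Deg< j φ → Linear φ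
  Deg<-linear zero φ≋0 = record
    { cong  = λ {v} {w} _ → ≋-trans (φ≋0 v) (≋-sym (φ≋0 w))
    ; +-hom = λ v w → ≋-trans (φ≋0 _) (≋-sym (≋-trans (⊕-identityʳ (φ≋0 w)) (φ≋0 v)))
    ; ·-hom = λ a v → ≋-trans (φ≋0 _) (≋-sym (≋-trans (·-cong refl (φ≋0 v)) (·-𝟘 a))) }
  Deg<-linear (suc j) {φ} (a , φ′ , φ′-low , φ≋) = record
    { cong  = λ {v} {w} v≋w → ≋-trans (φ≋ v) (≋-trans (⊕-cong (L.cong v≋w) (·-cong refl (P.cong v≋w))) (≋-sym (φ≋ w)))
    ; +-hom = λ v w → begin
        φ (v ⊕ w)                                                ≈⟨ φ≋ _ ⟩
        φ′ (v ⊕ w) ⊕ a · (T^ j) (v ⊕ w)                          ≈⟨ ⊕-cong (L.+-hom v w) (·-cong refl (P.+-hom v w)) ⟩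
        (φ′ v ⊕ φ′ w) ⊕ a · ((T^ j) v ⊕ (T^ j) w)                ≈⟨ (λ i → solve 5 (λ a x y s t → (x :+ y) :+ a :* (s :+ t) := (x :+ a :* s) :+ (y :+ a :* t)) refl a (φ′ v i) (φ′ w i) ((T^ j) v i) ((T^ j) w i)) ⟩
        (φ′ v ⊕ a · (T^ j) v) ⊕ (φ′ w ⊕ a · (T^ j) w)            ≈⟨ ⊕-cong (φ≋ v) (φ≋ w) ⟨
        φ v ⊕ φ w                                                ∎
    ; ·-hom = λ b v → begin
        φ (b · v)                            ≈⟨ φ≋ _ ⟩
        φ′ (b · v) ⊕ a · (T^ j) (b · v)      ≈⟨ ⊕-cong (L.·-hom b v) (·-cong refl (P.·-hom b v)) ⟩
        b · φ′ v ⊕ a · b · (T^ j) v          ≈⟨ (λ i → solve 4 (λ a b x t → b :* x :+ a :* (b :* t) := b :* (x :+ a :* t)) refl a b (φ′ v i) ((T^ j) v i)) ⟩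
        b · (φ′ v ⊕ a · (T^ j) v)            ≈⟨ ·-cong refl (φ≋ v) ⟨
        b · φ v                              ∎ }
    where
    module L = Linear (Deg<-linear j φ′-low)
    module P = Linear (T^-linear j)

  commute-T^ : ∀ {χ} → Linear χ → (∀ v → χ (T v) ≋ T (χ v)) → ∀ j v → χ ((T^ j) v) ≋ (T^ j) (χ v)
  commute-T^ χ-linear comm zero    v = ≋-refl
  commute-T^ χ-linear comm (suc j) v = ≋-trans (comm _) (T.cong (commute-T^ χ-linear comm j v))

  commute-Deg< : ∀ {χ} → Linear χ → (∀ v → χ (T v) ≋ T (χ v)) → ∀ j {φ} → Deg< j φ → ∀ v → χ (φ v) ≋ φ (χ v)
  commute-Deg< {χ} χ-linear comm zero φ≋0 v = ≋-trans (Linear.0-hom χ-linear (φ≋0 v)) (≋-sym (φ≋0 (χ v)))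
  commute-Deg< {χ} χ-linear comm (suc j) {φ} (a , φ′ , φ′-low , φ≋) v = begin
    χ (φ v)                              ≈⟨ X.cong (φ≋ v) ⟩
    χ (φ′ v ⊕ a · (T^ j) v)              ≈⟨ X.+-hom _ _ ⟩
    χ (φ′ v) ⊕ χ (a · (T^ j) v)          ≈⟨ ⊕-cong (commute-Deg< χ-linear comm j φ′-low v) (X.·-hom a _) ⟩
    φ′ (χ v) ⊕ a · χ ((T^ j) v)          ≈⟨ ⊕-cong ≋-refl (·-cong refl (commute-T^ χ-linear comm j v)) ⟩
    φ′ (χ v) ⊕ a · (T^ j) (χ v)          ≈⟨ φ≋ (χ v) ⟨
    φ (χ v)                              ∎
    where module X = Linear χ-linear

  IsPoly : Op → Set (c ⊔ ℓ)
  IsPoly φ = ∃ λ j → Deg< j φ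

  poly-linear : ∀ {φ} → IsPoly φ → Linear φ
  poly-linear (j , low) = Deg<-linear j low

  poly-commute : ∀ {φ ψ} → IsPoly φ → IsPoly ψ → ∀ v → φ (ψ v) ≋ ψ (φ v)
  poly-commute φ-poly (j , ψ-low) = commute-Deg< (poly-linear φ-poly)
    (λ v → ≋-sym (commute-Deg< T-linear (λ _ → ≋-refl) (proj₁ φ-poly) (proj₂ φ-poly) v)) j ψ-low

  poly-id : IsPoly id
  poly-id = 1 , T^-low 0

  poly-𝟘 : IsPoly (λ _ → 𝟘)
  poly-𝟘 = 0 , Deg<-𝟘 0

  poly-⊕ : ∀ {φ ψ} → IsPoly φ → IsPoly ψ → IsPoly (λ v → φ v ⊕ ψ v)
  poly-⊕ {φ} (i , φ-low) (j , ψ-low) = i ℕ.+ j ,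
    Deg<-⊕ (i ℕ.+ j) (≡.subst (λ k → Deg< k φ) (ℕP.+-comm j i) (Deg<-weaken j i φ-low)) (Deg<-weaken i j ψ-low)

  poly-· : ∀ a {φ} → IsPoly φ → IsPoly (λ v → a · φ v)
  poly-· a (j , low) = j , Deg<-· j a low

  poly-∘ : ∀ {φ ψ} → IsPoly φ → IsPoly ψ → IsPoly (φ ∘ ψ)
  poly-∘ (i , φ-low) (j , ψ-low) = i ℕ.+ j , Deg<-∘ i j φ-low ψ-low

  monic-poly : ∀ j {φ} → Monicᵒ j φ → IsPoly φ
  monic-poly j {φ} (ψ , ψ-low , φ≋) = suc j , 1# , ψ , ψ-low , λ v i → trans (φ≋ v i) (+-congˡ (sym (*-identityˡ _)))

  monic-zero : ∀ {φ} → Monicᵒ 0 φ → φ ≗ᵒ id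
  monic-zero (ψ , ψ≋0 , φ≋) v = ≋-trans (φ≋ v) (⊕-identityˡ (ψ≋0 v))

  -- Long division in `s` steps: the leading term, `a` times `T^ (s + j)`, is removed by subtracting
  -- `a` times `T^ s` of `δ`, which is monic of degree `j`.
  divide : ∀ {j δ} → Monicᵒ j δ → ∀ s {φ} → Deg< (s ℕ.+ j) φ →
           ∃₂ λ σ ρ → Deg< s σ × Deg< j ρ × (∀ v → φ v ≋ σ (δ v) ⊕ ρ v)
  divide δ-monic zero {φ} φ-low = (λ _ → 𝟘) , φ , (λ _ → ≋-refl) , φ-low , λ v → ≋-sym (⊕-identityˡ ≋-refl)
  divide {j} {δ} δ-monic@(δ′ , δ′-low , δ≋) (suc s) {φ} (a , φ′ , φ′-low , φ≋)
    with divide δ-monic s (Deg<-⊕ (s ℕ.+ j) φ′-low (Deg<-· (s ℕ.+ j) (- a) (Deg<-T^ s j δ′-low)))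
  ... | σ , ρ , σ-low , ρ-low , eq = (λ v → σ v ⊕ a · (T^ s) v) , ρ , (a , σ , σ-low , λ _ → ≋-refl) , ρ-low , λ v → begin
    φ v                                                         ≈⟨ φ≋ v ⟩
    φ′ v ⊕ a · (T^ (s ℕ.+ j)) v                                 ≈⟨ ⊕-cong ≋-refl (·-cong refl (T^-+ s j v)) ⟩
    φ′ v ⊕ a · (T^ s) ((T^ j) v)                                ≈⟨ (λ i → solve 4 (λ a x y z → x :+ a :* y := (x :+ (:- a) :* z) :+ a :* (z :+ y)) refl a (φ′ v i) ((T^ s) ((T^ j) v) i) ((T^ s) (δ′ v) i)) ⟩
    (φ′ v ⊕ (- a) · (T^ s) (δ′ v)) ⊕ a · ((T^ s) (δ′ v) ⊕ (T^ s) ((T^ j) v))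
                                                                ≈⟨ ⊕-cong (eq v) (·-cong refl (≋-trans (≋-sym (L.+-hom _ _)) (L.cong (≋-sym (δ≋ v))))) ⟩
    (σ (δ v) ⊕ ρ v) ⊕ a · (T^ s) (δ v)                          ≈⟨ (λ i → solve 3 (λ x y z → (x :+ y) :+ z := (x :+ z) :+ y) refl (σ (δ v) i) (ρ v i) ((a · (T^ s) (δ v)) i)) ⟩
    (σ (δ v) ⊕ a · (T^ s) (δ v)) ⊕ ρ v                          ∎
    where module L = Linear (T^-linear s)

  -- The first division step is made with leading coefficient `1#`, so that the quotient is seen to
  -- be monic of degree exactly `s`.
  divide-monic : ∀ {j δ} → Monicᵒ j δ → ∀ s {φ} → Monicᵒ (s ℕ.+ j) φ →
                 ∃₂ λ σ ρ → Monicᵒ s σ × Deg< j ρ × (∀ v → φ v ≋ σ (δ v) ⊕ ρ v)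
  divide-monic {j} {δ} δ-monic@(δ′ , δ′-low , δ≋) s {φ} (φ′ , φ′-low , φ≋)
    with divide δ-monic s (Deg<-⊕ (s ℕ.+ j) φ′-low (Deg<-· (s ℕ.+ j) (- 1#) (Deg<-T^ s j δ′-low)))
  ... | σ , ρ , σ-low , ρ-low , eq = (λ v → σ v ⊕ (T^ s) v) , ρ , (σ , σ-low , λ _ → ≋-refl) , ρ-low , λ v → begin
    φ v                                                         ≈⟨ φ≋ v ⟩
    φ′ v ⊕ (T^ (s ℕ.+ j)) v                                     ≈⟨ ⊕-cong ≋-refl (T^-+ s j v) ⟩
    φ′ v ⊕ (T^ s) ((T^ j) v)                                    ≈⟨ (λ i → solve 3 (λ x y z → x :+ y := (x :+ (:- con (+ 1)) :* z) :+ (z :+ y)) refl (φ′ v i) ((T^ s) ((T^ j) v) i) ((T^ s) (δ′ v) i)) ⟩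
    (φ′ v ⊕ (- 1#) · (T^ s) (δ′ v)) ⊕ ((T^ s) (δ′ v) ⊕ (T^ s) ((T^ j) v))
                                                                ≈⟨ ⊕-cong (eq v) (≋-trans (≋-sym (L.+-hom _ _)) (L.cong (≋-sym (δ≋ v)))) ⟩
    (σ (δ v) ⊕ ρ v) ⊕ (T^ s) (δ v)                              ≈⟨ (λ i → solve 3 (λ x y z → (x :+ y) :+ z := (x :+ z) :+ y) refl (σ (δ v) i) (ρ v i) ((T^ s) (δ v) i)) ⟩
    (σ (δ v) ⊕ (T^ s) (δ v)) ⊕ ρ v                              ∎
    where module L = Linear (T^-linear s)

  -- Drops vanishing leading coefficients and inverts the first nonzero one, by the decidable
  -- equality of the field.
  zero-or-monic : ∀ j {φ} → Deg< j φ → (∀ v → φ v ≋ 𝟘) ⊎ (∃₂ λ i a → i < j × Monicᵒ i (λ v → a · φ v))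
  zero-or-monic zero    φ≋0 = inj₁ φ≋0
  zero-or-monic (suc j) {φ} (a , ψ , ψ-low , φ≋) with a ≈? 0#
  ... | no a≉0 = let (b , ab≈1) = proj₂ isField a a≉0 in
    inj₂ (j , b , ℕP.≤-refl , (λ v → b · ψ v) , Deg<-· j b ψ-low , λ v → begin
      b · φ v                           ≈⟨ ·-cong refl (φ≋ v) ⟩
      b · (ψ v ⊕ a · (T^ j) v)          ≈⟨ (λ i → solve 4 (λ a b x t → b :* (x :+ a :* t) := b :* x :+ (a :* b) :* t) refl a b (ψ v i) ((T^ j) v i)) ⟩
      b · ψ v ⊕ (a * b) · (T^ j) v      ≈⟨ ⊕-cong ≋-refl (λ i → trans (*-congʳ ab≈1) (*-identityˡ _)) ⟩
      b · ψ v ⊕ (T^ j) v                ∎)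
  ... | yes a≈0 with zero-or-monic j (Deg<-resp j (λ v → ≋-sym (≋-trans (φ≋ v) (⊕-identityʳ (0·v _ a≈0)))) ψ-low)
  ...   | inj₁ φ≋0 = inj₁ φ≋0
  ...   | inj₂ (i , b , i<j , monic) = inj₂ (i , b , ℕP.m≤n⇒m≤1+n i<j , monic)

  -- Whatever annihilates `γ u` annihilates the image of `γ`. For `γ = id`, the annihilator of `u`
  -- is that of the whole space, the form in which a cyclic vector is used.
  HasGenerator : Op → Set (c ⊔ ℓ)
  HasGenerator γ = ∃ λ u → ∀ φ → IsPoly φ → φ (γ u) ≋ 𝟘 → ∀ v → φ (γ v) ≋ 𝟘

  Multiple : Op → Op → Set (c ⊔ ℓ)
  Multiple π η = ∃ λ α → IsPoly α × (∀ v → η v ≋ α (π v))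

  -- Membership of `φ` in the ideal generated by `π` and `η` among the polynomials in `T`;
  -- `Ideal π η id` says that the two are comaximal.
  Ideal : Op → Op → Op → Set (c ⊔ ℓ)
  Ideal π η φ = ∃₂ λ α β → IsPoly α × IsPoly β × (∀ v → φ v ≋ α (π v) ⊕ β (η v))

  ideal-left : ∀ π η → Ideal π η π
  ideal-left π η = id , (λ _ → 𝟘) , poly-id , poly-𝟘 , λ v → ≋-sym (⊕-identityʳ ≋-refl)

  ideal-right : ∀ π η → Ideal π η η
  ideal-right π η = (λ _ → 𝟘) , id , poly-𝟘 , poly-id , λ v → ≋-sym (⊕-identityˡ ≋-refl)

  ideal-∘ : ∀ {π η σ φ} → IsPoly σ → Ideal π η φ → Ideal π η (σ ∘ φ)
  ideal-∘ σ-poly (α , β , α-poly , β-poly , φ≋) = _ , _ , poly-∘ σ-poly α-poly , poly-∘ σ-poly β-poly ,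
    λ v → ≋-trans (L.cong (φ≋ v)) (L.+-hom _ _)
    where module L = Linear (poly-linear σ-poly)

  ideal-⊕ : ∀ {π η φ ψ} → Ideal π η φ → Ideal π η ψ → Ideal π η (λ v → φ v ⊕ ψ v)
  ideal-⊕ {π} {η} (α , β , α-poly , β-poly , φ≋) (γ , δ , γ-poly , δ-poly , ψ≋) =
    _ , _ , poly-⊕ α-poly γ-poly , poly-⊕ β-poly δ-poly , λ v → ≋-trans (⊕-cong (φ≋ v) (ψ≋ v))
      λ i → solve 4 (λ a b c d → (a :+ b) :+ (c :+ d) := (a :+ c) :+ (b :+ d)) refl (α (π v) i) (β (η v) i) (γ (π v) i) (δ (η v) i)

  ideal-· : ∀ {π η φ} a → Ideal π η φ → Ideal π η (λ v → a · φ v)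
  ideal-· a = ideal-∘ (poly-· a poly-id)

  ideal-resp : ∀ {π η φ ψ} → φ ≗ᵒ ψ → Ideal π η φ → Ideal π η ψ
  ideal-resp eq (α , β , α-poly , β-poly , φ≋) = α , β , α-poly , β-poly , λ v → ≋-trans (≋-sym (eq v)) (φ≋ v)

  -- Stated through the property that is used: modulo `π` every `η` is zero or invertible.
  Irreducible : Op → Set (c ⊔ ℓ)
  Irreducible π = ∀ η → IsPoly η → ¬ ¬ (Multiple π η ⊎ Ideal π η id)

  module _ {π γ : Op} (π-poly : IsPoly π) (γ-poly : IsPoly γ) (irreducible : Irreducible π) where
    private
      module γ = Linear (poly-linear γ-poly)

      stable : ∀ {v w} → ¬ ¬ (v ≋ w) → v ≋ w
      stable ¬¬eq i = decidable-stable (_ ≈? _) (λ neq → ¬¬eq (λ eq → neq (eq i)))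

      swap-zero : ∀ {φ ψ} → IsPoly φ → IsPoly ψ → ∀ {v} → ψ v ≋ 𝟘 → ψ (φ v) ≋ 𝟘
      swap-zero φ-poly ψ-poly {v} ψv≋0 =
        ≋-trans (poly-commute ψ-poly φ-poly v) (Linear.0-hom (poly-linear φ-poly) ψv≋0)

      ideal-zero : ∀ {η} → Ideal π η id → ∀ {v} → π v ≋ 𝟘 → η v ≋ 𝟘 → v ≋ 𝟘
      ideal-zero (α , β , α-poly , β-poly , eq) {v} πv≋0 ηv≋0 = ≋-trans (eq v)
        (≋-trans (⊕-identityʳ (Linear.0-hom (poly-linear β-poly) ηv≋0)) (Linear.0-hom (poly-linear α-poly) πv≋0))

    -- If `φ` kills `γ u` and is a multiple of `π`, the hypothesis on `π ∘ γ` applies to its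
    -- cofactor. The danger is an `η` comaximal with `π` that kills `γ u`. Either it kills the whole
    -- image of `γ`, and `u` still works, or some `η (γ z)` is nonzero, and `u ⊕ η z` replaces `u`.
    generator-step : HasGenerator (π ∘ γ) → ¬ ¬ HasGenerator γ
    generator-step (u , u-gen) k = ¬¬-em (∃ λ η → IsPoly η × η (γ u) ≋ 𝟘 × Ideal π η id) λ where
        (inj₂ none) → k (u , λ φ φ-poly φγu≋0 v → stable λ φγv≉0 → irreducible φ φ-poly λ where
          (inj₁ mult)  → φγv≉0 (via-multiple mult φγu≋0 v)
          (inj₂ comax) → none (φ , φ-poly , φγu≋0 , comax))
        (inj₁ (η , η-poly , ηγu≋0 , comax)) → ¬¬-em (∃ λ z → ¬ (η (γ z) ≋ 𝟘)) λ where
          (inj₂ none) → k (u , λ φ φ-poly φγu≋0 v → ideal-zero comax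
            (≋-trans (poly-commute π-poly φ-poly _) (u-gen φ φ-poly (swap-zero π-poly φ-poly φγu≋0) v))
            (swap-zero φ-poly η-poly (stable λ ηγv≉0 → none (v , ηγv≉0))))
          (inj₁ (z , y≉0)) → k (perturbed η-poly ηγu≋0 comax y≉0)
      where
      via-multiple : ∀ {φ} → Multiple π φ → φ (γ u) ≋ 𝟘 → ∀ v → φ (γ v) ≋ 𝟘
      via-multiple (α , α-poly , φ≋) φγu≋0 v =
        ≋-trans (φ≋ (γ v)) (u-gen α α-poly (≋-trans (≋-sym (φ≋ (γ u))) φγu≋0) v)

      -- η γ z has annihilator exactly (π), coprime to that of γ u, so adding it to γ u supplies the missing factor π.
      perturbed : ∀ {η} → IsPoly η → η (γ u) ≋ 𝟘 → Ideal π η id → ∀ {z} → ¬ (η (γ z) ≋ 𝟘) → HasGenerator γ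
      perturbed {η} η-poly ηγu≋0 comax {z} y≉0 = u ⊕ η z , λ φ φ-poly φγu′≋0 →
        let module φ = Linear (poly-linear φ-poly)
            module η = Linear (poly-linear η-poly)
            sum≋0 : φ (γ u) ⊕ φ y ≋ 𝟘
            sum≋0 = begin
              φ (γ u) ⊕ φ y            ≈⟨ φ.+-hom _ _ ⟨
              φ (γ u ⊕ y)              ≈⟨ φ.cong (⊕-cong ≋-refl (poly-commute η-poly γ-poly z)) ⟩
              φ (γ u ⊕ γ (η z))        ≈⟨ φ.cong (γ.+-hom _ _) ⟨
              φ (γ (u ⊕ η z))          ≈⟨ φγu′≋0 ⟩
              𝟘                        ∎
            ηφy≋0 : η (φ y) ≋ 𝟘
            ηφy≋0 = begin
              η (φ y)                  ≈⟨ ⊕-identityˡ (swap-zero φ-poly η-poly ηγu≋0) ⟨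
              η (φ (γ u)) ⊕ η (φ y)    ≈⟨ η.+-hom _ _ ⟨
              η (φ (γ u) ⊕ φ y)        ≈⟨ η.0-hom sum≋0 ⟩
              𝟘                        ∎
            φy≋0 : φ y ≋ 𝟘
            φy≋0 = ideal-zero comax (swap-zero φ-poly π-poly πy≋0) ηφy≋0
            φγu≋0 : φ (γ u) ≋ 𝟘
            φγu≋0 = ≋-trans (≋-sym (⊕-identityʳ φy≋0)) sum≋0
        in λ v → stable λ φγv≉0 → irreducible φ φ-poly λ where
          (inj₁ mult)   → φγv≉0 (via-multiple mult φγu≋0 v)
          (inj₂ comax′) → y≉0 (ideal-zero comax′ πy≋0 φy≋0)
        where
        y = η (γ z)
        πy≋0 : π y ≋ 𝟘
        πy≋0 = ≋-trans (poly-commute π-poly η-poly _) (u-gen η η-poly (swap-zero π-poly η-poly ηγu≋0) z)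

  CancelsFactors : ℕ → Set (c ⊔ ℓ)
  CancelsFactors N = ∀ {f γ} → Monicᵒ N f → IsPoly γ → HasGenerator (f ∘ γ) → ¬ ¬ HasGenerator γ

  generator-resp : ∀ {γ δ} → γ ≗ᵒ δ → HasGenerator γ → HasGenerator δ
  generator-resp eq (u , u-gen) = u , λ φ φ-poly φδu≋0 v →
    let module φ = Linear (poly-linear φ-poly) in
    ≋-trans (φ.cong (≋-sym (eq v))) (u-gen φ φ-poly (≋-trans (φ.cong (eq u)) φδu≋0) v)

  -- A monic element d of least degree in the ideal of f and η divides both, so it either shows
  -- that f is comaximal with η or divides η, or splits f into factors of smaller degree.
  cancel-factor : ∀ N → CancelsFactors N
  cancel-factor = <-rec CancelsFactors step
    where
    step : ∀ N → (∀ {M} → M < N → CancelsFactors M) → CancelsFactors N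
    step N smaller {f} {γ} f-monic γ-poly f-gen k =
      ¬¬-em (∃ λ η → IsPoly η × ¬ Multiple f η × ¬ Ideal f η id) λ where
        (inj₂ none) → generator-step (monic-poly N f-monic) γ-poly
          (λ η η-poly k′ → none (η , η-poly , k′ ∘ inj₁ , k′ ∘ inj₂)) f-gen k
        (inj₁ (η , η-poly , ¬mult , ¬comax)) →
          least (λ j → ∃ λ d → Monicᵒ j d × Ideal f η d) N (f , f-monic , ideal-left f η)
            λ (j , j≤N , (d , d-monic , d∈I) , below) → split η-poly ¬mult ¬comax j≤N d-monic d∈I below
      where
      split : ∀ {η} → IsPoly η → ¬ Multiple f η → ¬ Ideal f η id → ∀ {j} → j ≤ N → ∀ {d} → Monicᵒ j d → Ideal f η d →
              (∀ i → i < j → ¬ (∃ λ d → Monicᵒ i d × Ideal f η d)) → ⊥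
      split {η} (M , η-low) ¬mult ¬comax {j} j≤N {d} d-monic d∈I below = go j (N ℕ.∸ j) ≡.refl (ℕP.m∸n+n≡m j≤N)
        where
        remainder≋0 : ∀ {ρ σ φ} → Deg< j ρ → IsPoly σ → Ideal f η φ → (∀ v → φ v ≋ σ (d v) ⊕ ρ v) → ∀ v → φ v ≋ σ (d v)
        remainder≋0 {ρ} {σ} {φ} ρ-low σ-poly φ∈I φ≋ with zero-or-monic j ρ-low
        ... | inj₁ ρ≋0 = λ v → ≋-trans (φ≋ v) (⊕-identityʳ (ρ≋0 v))
        -- The remainder lies in the ideal; scaled to be monic, it would have degree below the least
        -- one.
        ... | inj₂ (i , a , i<j , monic) = ⊥-elim (below i i<j (_ , monic , ideal-· a (ideal-resp
          (λ v i → trans (+-congʳ (φ≋ v i)) (solve 2 (λ x y → (x :+ y) :+ (:- con (+ 1)) :* x := y) refl (σ (d v) i) (ρ v i)))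
          (ideal-⊕ φ∈I (ideal-· (- 1#) (ideal-∘ σ-poly d∈I))))))

        go : ∀ i s → i ≡ j → s ℕ.+ j ≡ N → ⊥
        go i s i≡j s+j≡N with divide-monic d-monic s (≡.subst (λ k → Monicᵒ k f) (≡.sym s+j≡N) f-monic) | divide d-monic M (≡.subst (λ k → Deg< k η) (ℕP.+-comm j M) (Deg<-weaken j M η-low))
        ... | σ , ρ , σ-monic , ρ-low , f≋ | τ , ρ′ , τ-low , ρ′-low , η≋ = cases i s i≡j s+j≡N σ-monic
          where
          f≋σd : f ≗ᵒ (σ ∘ d)
          f≋σd = remainder≋0 ρ-low (monic-poly s σ-monic) (ideal-left f η) f≋
          η≋τd : η ≗ᵒ (τ ∘ d)
          η≋τd = remainder≋0 ρ′-low (M , τ-low) (ideal-right f η) η≋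
          cases : ∀ i s → i ≡ j → s ℕ.+ j ≡ N → Monicᵒ s σ → ⊥
          -- If `d` has degree 0 it is the identity, and `f`, `η` are comaximal; if `σ` has degree
          -- 0, then `f` is `d` and divides `η`. Both were excluded.
          cases zero _ ≡.refl _ _ = ¬comax (ideal-resp (monic-zero d-monic) d∈I)
          cases (suc _) zero _ _ σ-monic = ¬mult (τ , (M , τ-low) , λ v → ≋-trans (η≋τd v)
            (Linear.cong (Deg<-linear M τ-low) (≋-sym (≋-trans (f≋σd v) (monic-zero σ-monic (d v))))))
          -- Both factors of `f` are proper: `σ` is cancelled from `σ ∘ (d ∘ γ)`, then `d` from
          -- `d ∘ γ`.
          cases (suc i) (suc s) ≡.refl ≡.refl σ-monic =
            smaller (ℕP.m<m+n (suc s) (s≤s z≤n)) σ-monic (poly-∘ (monic-poly (suc i) d-monic) γ-poly)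
              (generator-resp (λ v → f≋σd (γ v)) f-gen)
              λ dγ-gen → smaller (ℕP.m<n+m (suc i) (s≤s z≤n)) d-monic γ-poly dγ-gen k

  -- As `f` vanishes, even the zero vector generates for `f ∘ id`; cancelling all of `f` leaves the
  -- identity.
  cyclic-generator : ∀ {N f} → Monicᵒ N f → (∀ v → f v ≋ 𝟘) → ¬ ¬ HasGenerator id
  cyclic-generator {N} {f} f-monic f≋0 = cancel-factor N f-monic poly-id
    (𝟘 , λ φ φ-poly _ v → Linear.0-hom (poly-linear φ-poly) (f≋0 v))

-- Finite sums and matrices.

module Sums {c ℓ} (F : CommutativeRing c ℓ) where
  open CommutativeRing F hiding (zero)
  open IntegerCoefficients F

  ∑ : (n : ℕ) → (Fin n → Carrier) → Carrier
  ∑ = sumFin F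

  ∑-cong : ∀ n {f g} → (∀ i → f i ≈ g i) → ∑ n f ≈ ∑ n g
  ∑-cong zero    eq = refl
  ∑-cong (suc n) eq = +-cong (eq zero) (∑-cong n (eq ∘ suc))

  ∑-0 : ∀ n {f} → (∀ i → f i ≈ 0#) → ∑ n f ≈ 0#
  ∑-0 zero    eq = refl
  ∑-0 (suc n) eq = trans (+-cong (eq zero) (∑-0 n (eq ∘ suc))) (+-identityˡ 0#)

  ∑-+ : ∀ n f g → ∑ n (λ i → f i + g i) ≈ ∑ n f + ∑ n g
  ∑-+ zero    f g = sym (+-identityˡ 0#)
  ∑-+ (suc n) f g = trans (+-congˡ (∑-+ n (f ∘ suc) (g ∘ suc)))
    (solve 4 (λ a b c d → (a :+ b) :+ (c :+ d) := (a :+ c) :+ (b :+ d)) refl _ _ _ _)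

  ∑-*ˡ : ∀ n a f → ∑ n (λ i → a * f i) ≈ a * ∑ n f
  ∑-*ˡ zero    a f = sym (zeroʳ a)
  ∑-*ˡ (suc n) a f = trans (+-congˡ (∑-*ˡ n a (f ∘ suc))) (sym (distribˡ a _ _))

  ∑-*ʳ : ∀ n a f → ∑ n (λ i → f i * a) ≈ ∑ n f * a
  ∑-*ʳ n a f = trans (∑-cong n (λ i → *-comm (f i) a)) (trans (∑-*ˡ n a f) (*-comm a _))

  ∑-swap : ∀ m n (f : Fin m → Fin n → Carrier) → ∑ m (λ i → ∑ n (f i)) ≈ ∑ n (λ j → ∑ m (λ i → f i j))
  ∑-swap zero    n f = sym (∑-0 n (λ _ → refl))
  ∑-swap (suc m) n f = trans (+-congˡ (∑-swap m n (f ∘ suc))) (sym (∑-+ n (f zero) _))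

  ∑-last : ∀ n f → ∑ (suc n) f ≈ ∑ n (f ∘ inject₁) + f (Fin.fromℕ n)
  ∑-last zero    f = +-comm (f zero) 0#
  ∑-last (suc n) f = trans (+-congˡ (∑-last n (f ∘ suc))) (sym (+-assoc _ _ _))

  idM-suc : ∀ {n} (i j : Fin n) → idM F (suc i) (suc j) ≈ idM F i j
  idM-suc i j with i Fin.≟ j
  ... | yes _ = refl
  ... | no  _ = refl

  idM-diagonal : ∀ {n} (i : Fin n) → idM F i i ≈ 1#
  idM-diagonal i with i Fin.≟ i
  ... | yes _   = refl
  ... | no  i≢i = ⊥-elim (i≢i ≡.refl)

  idM-off-diagonal : ∀ {n} {i j : Fin n} → i ≢ j → idM F i j ≈ 0#
  idM-off-diagonal {i = i} {j} i≢j with i Fin.≟ j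
  ... | yes i≡j = ⊥-elim (i≢j i≡j)
  ... | no  _   = refl

  idM-sym : ∀ {n} (i j : Fin n) → idM F i j ≈ idM F j i
  idM-sym i j with i Fin.≟ j
  ... | yes ≡.refl = sym (idM-diagonal i)
  ... | no  i≢j    = sym (idM-off-diagonal (i≢j ∘ ≡.sym))

  ∑-idM : ∀ n (f : Fin n → Carrier) (j : Fin n) → ∑ n (λ t → f t * idM F t j) ≈ f j
  ∑-idM (suc n) f zero = trans (+-cong (*-identityʳ (f zero)) (∑-0 n (λ i → zeroʳ _))) (+-identityʳ _)
  ∑-idM (suc n) f (suc j) = trans (+-cong (zeroʳ (f zero))
    (trans (∑-cong n (λ t → *-congˡ (idM-suc t j))) (∑-idM n (f ∘ suc) j))) (+-identityˡ _)

module Matrices {c ℓ} (F : CommutativeRing c ℓ) (n : ℕ) where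
  open CommutativeRing F hiding (zero)
  open IntegerCoefficients F
  open Sums F
  open Vectors F n
  open Relation.Binary.Reasoning.Setoid setoid

  M : Set c
  M = Mat F n

  infix 4 _≈ₘ_
  infixl 6 _+ₘ_
  infixl 7 _*ₘ_
  infixr 8 _^ₘ_

  _≈ₘ_ : M → M → Set ℓ
  _≈ₘ_ = _≈M_ F

  _+ₘ_ _*ₘ_ : M → M → M
  _+ₘ_ = _+M_ F
  _*ₘ_ = _*M_ F

  _^ₘ_ : M → ℕ → M
  _^ₘ_ = _^M_ F

  apply : M → V → V
  apply X v i = ∑ n (λ t → X i t * v t)

  column : M → Fin n → V
  column X j i = X i j

  apply-linear : ∀ X → Linear (apply X)
  apply-linear X = record
    { cong  = λ v≋w i → ∑-cong n (λ t → *-congˡ (v≋w t))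
    ; +-hom = λ v w i → trans (∑-cong n (λ t → distribˡ _ _ _)) (∑-+ n _ _)
    ; ·-hom = λ a v i → trans (∑-cong n (λ t → solve 3 (λ x a y → x :* (a :* y) := a :* (x :* y)) refl (X i t) a (v t))) (∑-*ˡ n a _) }

  apply-congˡ : ∀ {X Y} → X ≈ₘ Y → ∀ v → apply X v ≋ apply Y v
  apply-congˡ X≈Y v i = ∑-cong n (λ t → *-congʳ (X≈Y i t))

  apply-+ₘ : ∀ X Y v → apply (X +ₘ Y) v ≋ apply X v ⊕ apply Y v
  apply-+ₘ X Y v i = trans (∑-cong n (λ t → distribʳ _ _ _)) (∑-+ n _ _)

  apply-scale : ∀ a X v → apply (scaleM F a X) v ≋ a · apply X v
  apply-scale a X v i = trans (∑-cong n (λ t → *-assoc a (X i t) (v t))) (∑-*ˡ n a _)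

  apply-*ₘ : ∀ X Y v → apply (X *ₘ Y) v ≋ apply X (apply Y v)
  apply-*ₘ X Y v i = begin
    ∑ n (λ t → ∑ n (λ s → X i s * Y s t) * v t)     ≈⟨ ∑-cong n (λ t → ∑-*ʳ n (v t) _) ⟨
    ∑ n (λ t → ∑ n (λ s → X i s * Y s t * v t))     ≈⟨ ∑-swap n n _ ⟩
    ∑ n (λ s → ∑ n (λ t → X i s * Y s t * v t))     ≈⟨ ∑-cong n (λ s → trans (∑-cong n (λ t → *-assoc _ _ _)) (∑-*ˡ n (X i s) _)) ⟩
    ∑ n (λ s → X i s * ∑ n (λ t → Y s t * v t))     ∎

  apply-id : ∀ v → apply (idM F) v ≋ v
  apply-id v i = trans (∑-cong n (λ t → trans (*-congʳ (idM-sym i t)) (*-comm _ _))) (∑-idM n v i)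

  apply-basis : ∀ X j → apply X (column (idM F) j) ≋ column X j
  apply-basis X j i = ∑-idM n (X i) j

  matrix-ext : ∀ {X Y} → (∀ v → apply X v ≋ apply Y v) → X ≈ₘ Y
  matrix-ext {X} {Y} eq i j = trans (sym (apply-basis X j i)) (trans (eq (column (idM F) j) i) (apply-basis Y j i))

  *ₘ-cong : ∀ {X X′ Y Y′} → X ≈ₘ X′ → Y ≈ₘ Y′ → X *ₘ Y ≈ₘ X′ *ₘ Y′
  *ₘ-cong p q i j = ∑-cong n (λ t → *-cong (p i t) (q t j))

  ^ₘ-cong : ∀ k {X Y} → X ≈ₘ Y → X ^ₘ k ≈ₘ Y ^ₘ k
  ^ₘ-cong zero    p i j = refl
  ^ₘ-cong (suc k) p = *ₘ-cong p (^ₘ-cong k p)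

  trace-comm : ∀ X Y → trace F (X *ₘ Y) ≈ trace F (Y *ₘ X)
  trace-comm X Y = trans (∑-swap n n _) (∑-cong n (λ j → ∑-cong n (λ i → *-comm _ _)))

-- The characteristic polynomial and the evaluation of polynomials at a matrix.

module CharacteristicPolynomial {c ℓ} (F : CommutativeRing c ℓ) where
  open CommutativeRing F using (Carrier; _*_; 0#; 1#)
  private
    infixl 6 _⊞_
    infixl 7 _⊠_
    _⊞_ _⊠_ : Poly F → Poly F → Poly F
    _⊞_ = _+P_ F
    _⊠_ = _*P_ F
    det : (n : ℕ) → (Fin n → Fin n → Poly F) → Poly F
    det = detWith _⊞_ _⊠_ (negP F) [] (1# ∷ [])

  length-⊞ˡ : ∀ f g → length f ≤ length (f ⊞ g)
  length-⊞ˡ []      g       = z≤n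
  length-⊞ˡ (a ∷ f) []      = ℕP.≤-refl
  length-⊞ˡ (a ∷ f) (b ∷ g) = s≤s (length-⊞ˡ f g)

  length-⊞ʳ : ∀ f g → length g ≤ length (f ⊞ g)
  length-⊞ʳ []      g       = ℕP.≤-refl
  length-⊞ʳ (a ∷ f) []      = z≤n
  length-⊞ʳ (a ∷ f) (b ∷ g) = s≤s (length-⊞ʳ f g)

  length-linear-⊠ : ∀ f g → 2 ≤ length f → suc (length g) ≤ length (f ⊠ g)
  length-linear-⊠ (a ∷ [])    g (s≤s ())
  length-linear-⊠ (a ∷ b ∷ f) g _ = ℕP.≤-trans
    (s≤s (ℕP.≤-trans (ℕP.≤-reflexive (≡.sym (length-map (b *_) g))) (length-⊞ˡ (map (b *_) g) (0# ∷ (f ⊠ g)))))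
    (length-⊞ʳ (map (a *_) g) (0# ∷ ((b ∷ f) ⊠ g)))

  -- The first term of the expansion already forces the length: it is a diagonal entry of length at
  -- least 2 times the next minor, and `_+P_` never trims its summands.
  length-det : ∀ n (D : Fin n → Fin n → Poly F) → (∀ i → 2 ≤ length (D i i)) → suc n ≤ length (det n D)
  length-det zero    D diag = ℕP.≤-refl
  length-det (suc n) D diag = ℕP.≤-trans
    (ℕP.≤-trans (s≤s (length-det n (λ r c → D (suc r) (suc c)) (diag ∘ suc))) (length-linear-⊠ (D zero zero) _ (diag zero)))
    (length-⊞ˡ (D zero zero ⊠ _) _)

  -- The matrix x·I − A is local to charPoly and has no name; unification recovers it.
  charMatrix : ∀ {n} (A : Mat F n) → ∃ λ D → charPoly F A ≡ det n D
  charMatrix A = _ , ≡.refl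

  charMatrix-diagonal : ∀ {n} (A : Mat F n) i → 2 ≤ length (proj₁ (charMatrix A) i i)
  charMatrix-diagonal A i with i Fin.≟ i
  ... | yes _   = ℕP.≤-refl
  ... | no  i≢i = ⊥-elim (i≢i ≡.refl)

  length-charPoly : ∀ {n} (A : Mat F n) → suc n ≤ length (charPoly F A)
  length-charPoly {n} A = length-det n (proj₁ (charMatrix A)) (charMatrix-diagonal A)

  monic⇒last : ∀ f → Monic F f → ∃ λ a → last f ≡ just a × CommutativeRing._≈_ F a 1#
  monic⇒last f f-monic with last f
  ... | just a = a , ≡.refl , f-monic

  monic-∷ʳ : ∀ f → Monic F (f ++ 1# ∷ [])
  monic-∷ʳ f with last (f ++ 1# ∷ []) | last-∷ʳ f
    where
    last-∷ʳ : ∀ (f : Poly F) → last (f ++ 1# ∷ []) ≡ just 1#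
    last-∷ʳ []          = ≡.refl
    last-∷ʳ (a ∷ [])    = ≡.refl
    last-∷ʳ (a ∷ b ∷ f) = last-∷ʳ (b ∷ f)
  ... | just _ | ≡.refl = CommutativeRing.refl F

module Evaluation {c ℓ} (F : CommutativeRing c ℓ) (isField : IsField F)
  (_≈?_ : ∀ x y → Dec (CommutativeRing._≈_ F x y)) (n : ℕ) (A : Mat F n) where
  open CommutativeRing F hiding (zero)
  open IntegerCoefficients F
  open Sums F
  open Vectors F n
  open Matrices F n
  open CharacteristicPolynomial F
  open PolynomialOperators F isField _≈?_ n (apply A) (apply-linear A) public
  open Relation.Binary.Reasoning.Setoid V-setoid
  private module T = Linear (apply-linear A)

  evalᵒ : Poly F → Op
  evalᵒ f = apply (evalM F f A)

  eval-[] : ∀ v → evalᵒ [] v ≋ 𝟘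
  eval-[] v i = ∑-0 n (λ t → zeroˡ (v t))

  eval-∷ : ∀ a f v → evalᵒ (a ∷ f) v ≋ a · v ⊕ apply A (evalᵒ f v)
  eval-∷ a f v = ≋-trans (apply-+ₘ _ _ v) (⊕-cong
    (≋-trans (apply-scale a (idM F) v) (·-cong refl (apply-id v))) (apply-*ₘ A (evalM F f A) v))

  -- `evalM` grows a polynomial at its constant term, `Deg<` at its leading term; this passes from
  -- one to the other.
  eval-∷ʳ : ∀ f a v → evalᵒ (f ++ a ∷ []) v ≋ evalᵒ f v ⊕ a · (T^ length f) v
  eval-∷ʳ []      a v = begin
    evalᵒ (a ∷ []) v                ≈⟨ eval-∷ a [] v ⟩
    a · v ⊕ apply A (evalᵒ [] v)    ≈⟨ ⊕-identityʳ (T.0-hom (eval-[] v)) ⟩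
    a · v                           ≈⟨ ⊕-identityˡ (eval-[] v) ⟨
    evalᵒ [] v ⊕ a · v              ∎
  eval-∷ʳ (b ∷ f) a v = begin
    evalᵒ (b ∷ f ++ a ∷ []) v                                  ≈⟨ eval-∷ b (f ++ a ∷ []) v ⟩
    b · v ⊕ apply A (evalᵒ (f ++ a ∷ []) v)                    ≈⟨ ⊕-cong ≋-refl (T.cong (eval-∷ʳ f a v)) ⟩
    b · v ⊕ apply A (evalᵒ f v ⊕ a · (T^ length f) v)          ≈⟨ ⊕-cong ≋-refl (≋-trans (T.+-hom _ _) (⊕-cong ≋-refl (T.·-hom a _))) ⟩
    b · v ⊕ (apply A (evalᵒ f v) ⊕ a · (T^ suc (length f)) v)  ≈⟨ (λ i → +-assoc _ _ _) ⟨
    b · v ⊕ apply A (evalᵒ f v) ⊕ a · (T^ suc (length f)) v    ≈⟨ ⊕-cong (eval-∷ b f v) ≋-refl ⟨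
    evalᵒ (b ∷ f) v ⊕ a · (T^ suc (length f)) v                ∎

  Deg<⇒eval : ∀ j {φ} → Deg< j φ → ∃ λ f → length f ≡ j × evalᵒ f ≗ᵒ φ
  Deg<⇒eval zero    φ≋0 = [] , ≡.refl , λ v → ≋-trans (eval-[] v) (≋-sym (φ≋0 v))
  Deg<⇒eval (suc j) (a , ψ , ψ-low , φ≋) with Deg<⇒eval j ψ-low
  ... | f , ≡.refl , f≋ψ = f ++ a ∷ [] , ≡.trans (length-++ f) (ℕP.+-comm (length f) 1) ,
    λ v → ≋-trans (eval-∷ʳ f a v) (≋-trans (⊕-cong (f≋ψ v) ≋-refl) (≋-sym (φ≋ v)))

  Monicᵒ⇒eval : ∀ j {φ} → Monicᵒ j φ → ∃ λ f → Monic F f × length f ≡ suc j × evalᵒ f ≗ᵒ φ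
  Monicᵒ⇒eval j (ψ , ψ-low , φ≋) with Deg<⇒eval j ψ-low
  ... | f , ≡.refl , f≋ψ = f ++ 1# ∷ [] , monic-∷ʳ f , ≡.trans (length-++ f) (ℕP.+-comm (length f) 1) ,
    λ v → ≋-trans (eval-∷ʳ f 1# v) (≋-trans (⊕-cong (f≋ψ v) (λ i → *-identityˡ _)) (≋-sym (φ≋ v)))

  monic-T+ : ∀ j {φ} a → Monicᵒ j φ → Monicᵒ (suc j) (λ v → apply A (φ v) ⊕ a · φ v)
  monic-T+ j {φ} a (ψ , ψ-low , φ≋) = (λ v → apply A (ψ v) ⊕ a · φ v) ,
    Deg<-⊕ (suc j) (Deg<-T j ψ-low) (Deg<-· (suc j) a (proj₂ (monic-poly j (ψ , ψ-low , φ≋)))) , λ v → begin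
      apply A (φ v) ⊕ a · φ v                       ≈⟨ ⊕-cong (≋-trans (T.cong (φ≋ v)) (T.+-hom _ _)) ≋-refl ⟩
      apply A (ψ v) ⊕ (T^ suc j) v ⊕ a · φ v        ≈⟨ (λ i → solve 3 (λ x y z → (x :+ y) :+ z := (x :+ z) :+ y) refl _ _ _) ⟩
      apply A (ψ v) ⊕ a · φ v ⊕ (T^ suc j) v        ∎

  eval-monic : ∀ f {a} → last f ≡ just a → a ≈ 1# → ∃ λ j → Monicᵒ j (evalᵒ f)
  eval-monic (a ∷ []) ≡.refl a≈1 = 0 , (λ _ → 𝟘) , (λ _ → ≋-refl) , λ v → begin
    evalᵒ (a ∷ []) v                ≈⟨ eval-∷ a [] v ⟩
    a · v ⊕ apply A (evalᵒ [] v)    ≈⟨ ⊕-identityʳ (T.0-hom (eval-[] v)) ⟩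
    a · v                           ≈⟨ (λ i → trans (*-congʳ a≈1) (*-identityˡ _)) ⟩
    v                               ≈⟨ ⊕-identityˡ ≋-refl ⟨
    𝟘 ⊕ v                           ∎
  eval-monic (a ∷ b ∷ f) eq a≈1 with eval-monic (b ∷ f) eq a≈1
  ... | j , ψ , ψ-low , φ≋ = suc j , (λ v → a · v ⊕ apply A (ψ v)) ,
    Deg<-⊕ (suc j) (≡.subst (λ k → Deg< k (λ v → a · v)) (ℕP.+-comm j 1) (Deg<-weaken j 1 (Deg<-· 1 a (T^-low 0)))) (Deg<-T j ψ-low) , λ v → begin
      evalᵒ (a ∷ b ∷ f) v                              ≈⟨ eval-∷ a (b ∷ f) v ⟩
      a · v ⊕ apply A (evalᵒ (b ∷ f) v)                ≈⟨ ⊕-cong ≋-refl (≋-trans (T.cong (φ≋ v)) (T.+-hom _ _)) ⟩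
      a · v ⊕ (apply A (ψ v) ⊕ (T^ suc j) v)           ≈⟨ (λ i → +-assoc _ _ _) ⟨
      a · v ⊕ apply A (ψ v) ⊕ (T^ suc j) v             ∎

  -- `Cyclic` contains that the characteristic polynomial is monic and kills `A`, which makes it the
  -- `f` to be cancelled.
  cyclic⇒generator : Cyclic F A → ¬ ¬ HasGenerator id
  cyclic⇒generator (monic , vanishes , _) =
    let (a , last≡ , a≈1) = monic⇒last (charPoly F A) monic
        (j , f-monic) = eval-monic (charPoly F A) last≡ a≈1
    in cyclic-generator f-monic (λ v i → ∑-0 n (λ t → trans (*-congʳ (vanishes i t)) (zeroˡ _)))

  -- A monic annihilator of degree `j` is a list of length `suc j`, and minimality together with the
  -- lower bound `suc n` for the characteristic polynomial excludes `j < n`.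
  cyclic⇒no-small-annihilator : Cyclic F A → ∀ j {φ} → j < n → Monicᵒ j φ → ¬ (∀ v → φ v ≋ 𝟘)
  cyclic⇒no-small-annihilator (_ , _ , minimal) j j<n φ-monic φ≋0 =
    let (f , f-monic , length≡ , f≋φ) = Monicᵒ⇒eval j φ-monic
        f-zero = matrix-ext (λ v → ≋-trans (f≋φ v) (≋-trans (φ≋0 v) (≋-sym (λ i → ∑-0 n (λ t → zeroˡ (v t))))))
    in ℕP.<⇒≱ j<n (ℕP.≤-pred (≡.subst (suc n ≤_) length≡
         (ℕP.≤-trans (length-charPoly A) (minimal f f-monic f-zero))))

-- Diagonalisation and k-th roots of diagonalisable matrices.

module Eigenvectors {c ℓ} (F : CommutativeRing c ℓ) (isField : IsField F) (n : ℕ) (X : Mat F n)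
  {m : ℕ} (eigenvalue : Fin m → CommutativeRing.Carrier F)
  (eigenvalue-injective : ∀ {i j} → CommutativeRing._≈_ F (eigenvalue i) (eigenvalue j) → i ≡ j) where
  open CommutativeRing F hiding (zero)
  open IntegerCoefficients F
  open FieldProperties F isField using (x≉y⇒x-y≉0)
  open Sums F
  open Vectors F n
  open Matrices F n
  open Relation.Binary.Reasoning.Setoid V-setoid
  private
    module T = Linear (apply-linear X)
    T = apply X

  -- Sums of eigenvectors with eigenvalue indices in `E`, without a chosen basis. `E` is tracked
  -- because an eigenvalue can be adjoined safely while it is still absent.
  data Span (E : Fin m → Set) : V → Set (c ⊔ ℓ) where
    eigenvector : ∀ {v} i → E i → T v ≋ eigenvalue i · v → Span E v
    sum         : ∀ {v w x} → Span E v → Span E w → x ≋ v ⊕ w → Span E x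
    null        : ∀ {v} → v ≋ 𝟘 → Span E v

  span-mono : ∀ {E E′} → (∀ {i} → E i → E′ i) → ∀ {v} → Span E v → Span E′ v
  span-mono E⊆E′ (eigenvector i Ei eq) = eigenvector i (E⊆E′ Ei) eq
  span-mono E⊆E′ (sum s t eq)          = sum (span-mono E⊆E′ s) (span-mono E⊆E′ t) eq
  span-mono E⊆E′ (null eq)             = null eq

  span-· : ∀ {E} a {v w} → Span E v → w ≋ a · v → Span E w
  span-· a {v} {w} (eigenvector i Ei eq) w≋ = eigenvector i Ei (begin
    T w                     ≈⟨ T.cong w≋ ⟩
    T (a · v)               ≈⟨ T.·-hom a v ⟩
    a · T v                 ≈⟨ ·-cong refl eq ⟩
    a · eigenvalue i · v    ≈⟨ (λ j → solve 3 (λ a b x → a :* (b :* x) := b :* (a :* x)) refl a (eigenvalue i) (v j)) ⟩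
    eigenvalue i · a · v    ≈⟨ ·-cong refl w≋ ⟨
    eigenvalue i · w        ∎)
  span-· a (sum s t eq) w≋ = sum (span-· a s ≋-refl) (span-· a t ≋-refl)
    (≋-trans w≋ (λ i → trans (*-congˡ (eq i)) (distribˡ a _ _)))
  span-· a (null eq) w≋ = null (≋-trans w≋ (≋-trans (·-cong refl eq) (·-𝟘 a)))

  span-combination : ∀ {E} k (W : Fin k → V) (a : Fin k → Carrier) → (∀ t → Span E (W t)) →
                     Span E (λ r → ∑ k (λ t → W t r * a t))
  span-combination zero    W a spans = null ≋-refl
  span-combination (suc k) W a spans = sum (span-· (a zero) (spans zero) (λ r → *-comm _ _))
    (span-combination k (W ∘ suc) (a ∘ suc) (spans ∘ suc)) ≋-refl

  -- On an eigenvector for `eigenvalue i`, the operator `T - eigenvalue j` is multiplication by a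
  -- nonzero gap, so the equation is solved term by term.
  resolvent : ∀ {E j} → ¬ E j → ∀ {w} → Span E w → ∃ λ z → Span E z × T z ≋ eigenvalue j · z ⊕ w
  resolvent {E} {j} ¬Ej {w} (eigenvector i Ei eq)
    with proj₂ isField (eigenvalue i - eigenvalue j) (x≉y⇒x-y≉0 (λ e → ¬Ej (≡.subst E (eigenvalue-injective e) Ei)))
  ... | b , gap*b≈1 = b · w , span-· b (eigenvector i Ei eq) ≋-refl , (begin
    T (b · w)                           ≈⟨ T.·-hom b w ⟩
    b · T w                             ≈⟨ ·-cong refl eq ⟩
    b · eigenvalue i · w                ≈⟨ (λ t → solve 4 (λ b x y w → b :* (x :* w) := y :* (b :* w) :+ (x :- y) :* b :* w) refl b (eigenvalue i) (eigenvalue j) (w t)) ⟩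
    eigenvalue j · b · w ⊕ ((eigenvalue i - eigenvalue j) * b) · w
                                        ≈⟨ ⊕-cong ≋-refl (λ t → trans (*-congʳ gap*b≈1) (*-identityˡ _)) ⟩
    eigenvalue j · b · w ⊕ w            ∎)
  resolvent {j = j} ¬Ej {w} (sum {v₁} {v₂} s t eq) with resolvent ¬Ej s | resolvent ¬Ej t
  ... | y , y-span , Ty≋ | z , z-span , Tz≋ = y ⊕ z , sum y-span z-span ≋-refl , (begin
    T (y ⊕ z)                                                   ≈⟨ T.+-hom y z ⟩
    T y ⊕ T z                                                   ≈⟨ ⊕-cong Ty≋ Tz≋ ⟩
    (eigenvalue j · y ⊕ v₁) ⊕ (eigenvalue j · z ⊕ v₂)           ≈⟨ (λ t → solve 5 (λ b y z v w → (b :* y :+ v) :+ (b :* z :+ w) := b :* (y :+ z) :+ (v :+ w)) refl (eigenvalue j) (y t) (z t) (v₁ t) (v₂ t)) ⟩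
    eigenvalue j · (y ⊕ z) ⊕ (v₁ ⊕ v₂)                          ≈⟨ ⊕-cong ≋-refl eq ⟨
    eigenvalue j · (y ⊕ z) ⊕ w                                  ∎)
  resolvent ¬Ej (null eq) = 𝟘 , null ≋-refl , ≋-trans (T.0-hom ≋-refl) (≋-sym (≋-trans (⊕-identityʳ eq) (·-𝟘 _)))

  -- One step of diagonalising a triangular matrix: if `z` solves `(T - eigenvalue j) z = w`, then
  -- `v - z` is an eigenvector for `eigenvalue j`.
  span-extend : ∀ {E E′} {j} → ¬ E j → (∀ {i} → E i → E′ i) → E′ j → ∀ {v w} →
                Span E w → T v ≋ eigenvalue j · v ⊕ w → Span E′ v
  span-extend {j = j} ¬Ej E⊆E′ E′j {v} {w} w-span Tv≋ with resolvent ¬Ej w-span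
  ... | z , z-span , Tz≋ = sum (span-mono E⊆E′ z-span) (eigenvector {v = v ⊕ (- 1#) · z} j E′j (begin
    T (v ⊕ (- 1#) · z)                                              ≈⟨ ≋-trans (T.+-hom _ _) (⊕-cong ≋-refl (T.·-hom _ _)) ⟩
    T v ⊕ (- 1#) · T z                                              ≈⟨ ⊕-cong Tv≋ (·-cong refl Tz≋) ⟩
    (eigenvalue j · v ⊕ w) ⊕ (- 1#) · (eigenvalue j · z ⊕ w)        ≈⟨ (λ t → solve 4 (λ b v w z → (b :* v :+ w) :+ (:- con (+ 1)) :* (b :* z :+ w) := b :* (v :+ (:- con (+ 1)) :* z)) refl (eigenvalue j) (v t) (w t) (z t)) ⟩
    eigenvalue j · (v ⊕ (- 1#) · z)                                 ∎))
    (λ t → solve 2 (λ v z → v := z :+ (v :+ (:- con (+ 1)) :* z)) refl (v t) (z t))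

module Roots {c ℓ} (F : CommutativeRing c ℓ) (isField : IsField F) (n : ℕ) (X : Mat F n) where
  open CommutativeRing F hiding (zero)
  open IntegerCoefficients F
  open FieldProperties F isField using (x≉y⇒x-y≉0; _^_)
  open Vectors F n
  open Matrices F n
  open Relation.Binary.Reasoning.Setoid V-setoid

  -- Newton interpolation evaluated at `X`: `G = r zero + G′ (X - a zero)`, where `G′` takes the
  -- divided differences at the remaining nodes.
  interpolate : ∀ {m} (a r : Fin m → Carrier) → (∀ {i j} → a i ≈ a j → i ≡ j) →
                ∃ λ G → ∀ i v → apply X v ≋ a i · v → apply G v ≋ r i · v
  -- Without nodes the condition is empty, and `X` is an arbitrary choice.
  interpolate {zero}  a r a-inj = X , λ ()
  interpolate {suc m} a r a-inj = G , G-eigen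
    where
    gap : ∀ i → ∃ λ b → (a (suc i) - a zero) * b ≈ 1#
    gap i = proj₂ isField _ (x≉y⇒x-y≉0 λ eq → FinP.0≢1+n (≡.sym (a-inj eq)))
    rest = interpolate (a ∘ suc) (λ i → (r (suc i) - r zero) * proj₁ (gap i)) (FinP.suc-injective ∘ a-inj)
    G′ = proj₁ rest
    module G′ = Linear (apply-linear G′)
    shift : M
    shift = X +ₘ scaleM F (- a zero) (idM F)
    G : M
    G = scaleM F (r zero) (idM F) +ₘ G′ *ₘ shift
    apply-shift : ∀ b v → apply X v ≋ b · v → apply shift v ≋ (b - a zero) · v
    apply-shift b v eq = begin
      apply shift v                                          ≈⟨ apply-+ₘ _ _ v ⟩
      apply X v ⊕ apply (scaleM F (- a zero) (idM F)) v      ≈⟨ ⊕-cong eq (≋-trans (apply-scale _ _ v) (·-cong refl (apply-id v))) ⟩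
      b · v ⊕ (- a zero) · v                                 ≈⟨ (λ t → sym (distribʳ (v t) b (- a zero))) ⟩
      (b - a zero) · v                                       ∎
    apply-G : ∀ b v → apply X v ≋ b · v → apply G v ≋ r zero · v ⊕ (b - a zero) · apply G′ v
    apply-G b v eq = begin
      apply G v                                              ≈⟨ apply-+ₘ _ _ v ⟩
      apply (scaleM F (r zero) (idM F)) v ⊕ apply (G′ *ₘ shift) v
                                                             ≈⟨ ⊕-cong (≋-trans (apply-scale _ _ v) (·-cong refl (apply-id v))) (apply-*ₘ G′ shift v) ⟩
      r zero · v ⊕ apply G′ (apply shift v)                  ≈⟨ ⊕-cong ≋-refl (≋-trans (G′.cong (apply-shift b v eq)) (G′.·-hom _ v)) ⟩
      r zero · v ⊕ (b - a zero) · apply G′ v                 ∎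
    G-eigen : ∀ i v → apply X v ≋ a i · v → apply G v ≋ r i · v
    G-eigen zero    v eq = ≋-trans (apply-G (a zero) v eq) (⊕-identityʳ (0·v _ (-‿inverseʳ (a zero))))
    G-eigen (suc i) v eq = begin
      apply G v                                                        ≈⟨ apply-G (a (suc i)) v eq ⟩
      r zero · v ⊕ (a (suc i) - a zero) · apply G′ v                   ≈⟨ ⊕-cong ≋-refl (·-cong refl (proj₂ rest i v eq)) ⟩
      r zero · v ⊕ (a (suc i) - a zero) · ((r (suc i) - r zero) * b) · v
                                                                       ≈⟨ (λ t → solve 5 (λ r₀ rᵢ g b v → r₀ :* v :+ g :* (((rᵢ :- r₀) :* b) :* v) := r₀ :* v :+ (g :* b) :* ((rᵢ :- r₀) :* v)) refl (r zero) (r (suc i)) (a (suc i) - a zero) b (v t)) ⟩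
      r zero · v ⊕ ((a (suc i) - a zero) * b) · (r (suc i) - r zero) · v
                                                                       ≈⟨ ⊕-cong ≋-refl (·-cong (proj₂ (gap i)) ≋-refl) ⟩
      r zero · v ⊕ 1# · (r (suc i) - r zero) · v                       ≈⟨ (λ t → solve 3 (λ r₀ rᵢ v → r₀ :* v :+ con (+ 1) :* ((rᵢ :- r₀) :* v) := rᵢ :* v) refl (r zero) (r (suc i)) (v t)) ⟩
      r (suc i) · v                                                    ∎
      where b = proj₁ (gap i)

  apply-^ₘ : ∀ {G r v} → apply G v ≋ r · v → ∀ k → apply (G ^ₘ k) v ≋ (r ^ k) · v
  apply-^ₘ {G} {r} {v} eq zero    = ≋-trans (apply-id v) (λ t → sym (*-identityˡ _))
  apply-^ₘ {G} {r} {v} eq (suc k) = begin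
    apply (G *ₘ G ^ₘ k) v        ≈⟨ apply-*ₘ G (G ^ₘ k) v ⟩
    apply G (apply (G ^ₘ k) v)   ≈⟨ G.cong (apply-^ₘ eq k) ⟩
    apply G ((r ^ k) · v)        ≈⟨ G.·-hom _ v ⟩
    (r ^ k) · apply G v          ≈⟨ ·-cong refl eq ⟩
    (r ^ k) · r · v              ≈⟨ (λ t → solve 3 (λ x r v → x :* (r :* v) := (r :* x) :* v) refl (r ^ k) r (v t)) ⟩
    (r ^ suc k) · v              ∎
    where module G = Linear (apply-linear G)

  -- G interpolates k-th roots of the eigenvalues, so G ^ k and X agree on every eigenvector.
  diagonalisable⇒power : ∀ {m} (a r : Fin m → Carrier) (a-inj : ∀ {i j} → a i ≈ a j → i ≡ j) → ∀ k →
    (∀ i → r i ^ k ≈ a i) → (∀ v → Eigenvectors.Span F isField n X a a-inj (λ _ → ⊤) v) → ∃ λ G → X ≈ₘ G ^ₘ k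
  diagonalisable⇒power a r a-inj k rᵏ≈a spans = G , matrix-ext (λ v → ≋-sym (agree (spans v)))
    where
    open Eigenvectors F isField n X a a-inj
    G = proj₁ (interpolate a r a-inj)
    module X = Linear (apply-linear X)
    module Gᵏ = Linear (apply-linear (G ^ₘ k))
    agree : ∀ {v} → Span (λ _ → ⊤) v → apply (G ^ₘ k) v ≋ apply X v
    agree {v} (eigenvector i _ eq) = begin
      apply (G ^ₘ k) v    ≈⟨ apply-^ₘ (proj₂ (interpolate a r a-inj) i v eq) k ⟩
      (r i ^ k) · v       ≈⟨ ·-cong (rᵏ≈a i) ≋-refl ⟩
      a i · v             ≈⟨ eq ⟨
      apply X v           ∎
    agree {x} (sum {v} {w} s t eq) = begin
      apply (G ^ₘ k) x                          ≈⟨ ≋-trans (Gᵏ.cong eq) (Gᵏ.+-hom v w) ⟩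
      apply (G ^ₘ k) v ⊕ apply (G ^ₘ k) w       ≈⟨ ⊕-cong (agree s) (agree t) ⟩
      apply X v ⊕ apply X w                     ≈⟨ ≋-trans (X.cong eq) (X.+-hom v w) ⟨
      apply X x                                 ∎
    agree (null eq) = ≋-trans (Gᵏ.0-hom eq) (≋-sym (X.0-hom eq))

-- Matrices over a finite field: inverses by counting, and exhaustive search.

module FiniteMatrices {c ℓ} (F : CommutativeRing c ℓ) (isField : IsField F) (q′ : ℕ) (card : HasCard F (suc q′)) (n : ℕ) where
  open CommutativeRing F hiding (zero)
  open IntegerCoefficients F
  open FieldProperties F isField using (x-y≈0⇒x≈y)
  open FiniteField F isField q′ card using (_≈?_; element-injective)
  open Inverse card using () renaming (to to index; from to element; from-cong to element-cong; strictlyInverseʳ to element-index)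
  open Sums F
  open Vectors F n
  open Matrices F n
  open Relation.Binary.Reasoning.Setoid V-setoid

  encode : V → Fin (suc q′ ℕ.^ n)
  encode v = funToFin (index ∘ v)

  decode : Fin (suc q′ ℕ.^ n) → V
  decode x = element ∘ finToFun x

  decode-encode : ∀ v → decode (encode v) ≋ v
  decode-encode v i = trans (element-cong (FinP.finToFun-funToFin (index ∘ v) i)) (element-index (v i))

  encode-injective : ∀ {v w} → encode v ≡ encode w → v ≋ w
  encode-injective {v} {w} eq = ≋-trans (≋-sym (decode-encode v))
    (≋-trans (λ i → reflexive (≡.cong (λ x → decode x i) eq)) (decode-encode w))

  decode-injective : ∀ {x y} → decode x ≋ decode y → x ≡ y
  decode-injective {x} {y} eq = ≡.trans (≡.sym (FinP.funToFin-finToFin {n} {suc q′} x)) (≡.trans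
    (funToFin-cong n (λ i → element-injective (eq i))) (FinP.funToFin-finToFin {n} {suc q′} y))
    where
    funToFin-cong : ∀ m {f g : Fin m → Fin (suc q′)} → (∀ i → f i ≡ g i) → funToFin f ≡ funToFin g
    funToFin-cong zero    eq = ≡.refl
    funToFin-cong (suc m) eq = ≡.cong₂ Fin.combine (eq zero) (funToFin-cong m (eq ∘ suc))

  module _ (P : M) (kernel : ∀ v → apply P v ≋ 𝟘 → v ≋ 𝟘) where
    private module P = Linear (apply-linear P)

    P-injective : ∀ {v w} → apply P v ≋ apply P w → v ≋ w
    P-injective {v} {w} eq i = x-y≈0⇒x≈y (trans (+-congˡ (solve 1 (λ x → :- x := (:- con (+ 1)) :* x) refl (w i)))
      (kernel (v ⊕ (- 1#) · w) (begin
        apply P (v ⊕ (- 1#) · w)              ≈⟨ ≋-trans (P.+-hom _ _) (⊕-cong ≋-refl (P.·-hom _ _)) ⟩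
        apply P v ⊕ (- 1#) · apply P w        ≈⟨ ⊕-cong eq ≋-refl ⟩
        apply P w ⊕ (- 1#) · apply P w        ≈⟨ (λ t → solve 1 (λ x → x :+ (:- con (+ 1)) :* x := con (+ 0)) refl (apply P w t)) ⟩
        𝟘                                     ∎) i))

    -- An injective self-map of the finite set of vectors is onto; `encode` and `decode` carry the
    -- pigeonhole principle over from `Fin`.
    P-surjective : ∀ w → ∃ λ v → apply P v ≋ w
    P-surjective w = let (x , eq) = injective⇒surjective (encode ∘ apply P ∘ decode)
                           (decode-injective ∘ P-injective ∘ encode-injective) (encode w)
                     in decode x , encode-injective eq

    inverse : ∃ λ Q → (∀ v → apply P (apply Q v) ≋ v) × (∀ v → apply Q (apply P v) ≋ v)
    inverse = Q , PQ , λ v → P-injective (PQ (apply P v))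
      where
      Q : M
      Q i j = proj₁ (P-surjective (column (idM F) j)) i
      PQ : ∀ v → apply P (apply Q v) ≋ v
      PQ v = begin
        apply P (apply Q v)    ≈⟨ apply-*ₘ P Q v ⟨
        apply (P *ₘ Q) v       ≈⟨ apply-congˡ (λ i j → proj₂ (P-surjective (column (idM F) j)) i) v ⟩
        apply (idM F) v        ≈⟨ apply-id v ⟩
        v                      ∎

  decodeₘ : Fin ((suc q′ ℕ.^ n) ℕ.^ n) → M
  decodeₘ x i = decode (finToFun x i)

  decodeₘ-surjective : ∀ X → ∃ λ x → decodeₘ x ≈ₘ X
  decodeₘ-surjective X = funToFin (λ i → encode (X i)) , λ i j →
    trans (reflexive (≡.cong (λ y → decode y j) (FinP.finToFun-funToFin (λ i → encode (X i)) i))) (decode-encode (X i) j)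

  sum-of-powers-stable : ∀ A k → ¬ ¬ (∃₂ λ B C → A ≈ₘ B ^ₘ k +ₘ C ^ₘ k) → ∃₂ λ B C → A ≈ₘ B ^ₘ k +ₘ C ^ₘ k
  sum-of-powers-stable A k ¬¬sum =
    let (x , y , eq) = decidable-stable coded? (λ ¬coded → ¬¬sum λ (B , C , A≈) →
          let (x , x≈B) = decodeₘ-surjective B
              (y , y≈C) = decodeₘ-surjective C
          in ¬coded (x , y , λ i j → trans (A≈ i j) (sym (+-cong (^ₘ-cong k x≈B i j) (^ₘ-cong k y≈C i j)))))
    in decodeₘ x , decodeₘ y , eq
    where
    coded? : Dec (∃₂ λ x y → A ≈ₘ decodeₘ x ^ₘ k +ₘ decodeₘ y ^ₘ k)
    coded? = FinP.any? λ x → FinP.any? λ y → FinP.all? λ i → FinP.all? λ j → _ ≈? _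

-- The adapted basis and the two summands.

module Decomposition {c ℓ} (F : CommutativeRing c ℓ) (isField : IsField F) (q′ : ℕ) (card : HasCard F (suc q′))
  (n′ : ℕ) (A : Mat F (suc n′)) (cyclic : Cyclic F A) where
  n = suc n′
  open CommutativeRing F hiding (zero)
  open IntegerCoefficients F
  open FieldProperties F isField using (ι; *-cancelˡ-≉0; *-≉0; 0≉1; 1^n≈1; ^-distrib-*) renaming (_^_ to _^ᶠ_)
  open FiniteField F isField q′ card using (_≈?_)
  open Algebra.Properties.Group +-group using (∙-cancelˡ)
  open Sums F
  open Vectors F n
  open Matrices F n
  open Evaluation F isField _≈?_ n A
  open FiniteMatrices F isField q′ card n
  open Relation.Binary.Reasoning.Setoid setoid

  module Newton (α : ℕ → Carrier) where

    -- The Newton products of the factors `A - α 0`, ..., `A - α (i - 1)`. Applied to a generator,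
    -- the first `n` of them give a basis in which `α` prescribes the diagonal of `A` except for its
    -- last entry.
    N : ℕ → Op
    N zero    v = v
    N (suc i) v = apply A (N i v) ⊕ (- α i) · N i v

    N-monic : ∀ i → Monicᵒ i (N i)
    N-monic zero    = (λ _ → 𝟘) , (λ _ → ≋-refl) , λ v → ≋-sym (⊕-identityˡ ≋-refl)
    N-monic (suc i) = monic-T+ i (- α i) (N-monic i)

    A-N : ∀ i v → apply A (N i v) ≋ α i · N i v ⊕ N (suc i) v
    A-N i v t = solve 3 (λ a x y → y := a :* x :+ (y :+ (:- a) :* x)) refl (α i) (N i v t) (apply A (N i v) t)

    combination : ∀ m → (Fin m → Carrier) → Op
    combination m a v r = ∑ m (λ i → N (toℕ i) v r * a i)

    combination-last : ∀ m a v → combination (suc m) a v ≋ combination m (a ∘ inject₁) v ⊕ a (Fin.fromℕ m) · N m v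
    combination-last m a v r = trans (∑-last m (λ i → N (toℕ i) v r * a i)) (+-cong
      (∑-cong m (λ i → *-congʳ (reflexive (≡.cong (λ k → N k v r) (FinP.toℕ-inject₁ i)))))
      (trans (*-congʳ (reflexive (≡.cong (λ k → N k v r) (FinP.toℕ-fromℕ m)))) (*-comm _ _)))

    combination-low : ∀ m a → Deg< m (combination m a)
    combination-low zero    a = λ v → ≋-refl
    combination-low (suc m) a = Deg<-resp (suc m) (λ v → ≋-sym (combination-last m a v))
      (Deg<-⊕ (suc m) (Deg<-suc m (combination-low m (a ∘ inject₁)))
        (Deg<-· (suc m) (a (Fin.fromℕ m)) (proj₂ (monic-poly m (N-monic m)))))

    -- `N m` is monic of degree `m`, so the last nonzero coefficient is the leading one. In contrast
    -- to `zero-or-monic`, the first outcome concerns the coefficients and not just the operator.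
    trivial-or-monic : ∀ m a → (∀ i → a i ≈ 0#) ⊎ (∃₂ λ j b → j < m × Monicᵒ j (λ v → b · combination m a v))
    trivial-or-monic zero    a = inj₁ λ ()
    trivial-or-monic (suc m) a with a (Fin.fromℕ m) ≈? 0#
    ... | no aₘ≉0 = let (b , ab≈1) = proj₂ isField _ aₘ≉0
                        (ψ , ψ-low , N≋) = N-monic m in
      inj₂ (m , b , ℕP.≤-refl , (λ v → b · combination m (a ∘ inject₁) v ⊕ ψ v) ,
        Deg<-⊕ m (Deg<-· m b (combination-low m (a ∘ inject₁))) ψ-low , λ v t → begin
          b * combination (suc m) a v t                                        ≈⟨ *-congˡ (combination-last m a v t) ⟩
          b * (combination m (a ∘ inject₁) v t + a (Fin.fromℕ m) * N m v t)    ≈⟨ solve 4 (λ b x a y → b :* (x :+ a :* y) := b :* x :+ (a :* b) :* y) refl b _ (a (Fin.fromℕ m)) (N m v t) ⟩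
          b * combination m (a ∘ inject₁) v t + a (Fin.fromℕ m) * b * N m v t  ≈⟨ +-congˡ (trans (*-congʳ ab≈1) (*-identityˡ _)) ⟩
          b * combination m (a ∘ inject₁) v t + N m v t                        ≈⟨ +-congˡ (N≋ v t) ⟩
          b * combination m (a ∘ inject₁) v t + (ψ v t + (T^ m) v t)           ≈⟨ +-assoc _ _ _ ⟨
          b * combination m (a ∘ inject₁) v t + ψ v t + (T^ m) v t             ∎)
    ... | yes aₘ≈0 with trivial-or-monic m (a ∘ inject₁)
    ...   | inj₁ a≈0 = inj₁ all≈0
      where
      all≈0 : ∀ i → a i ≈ 0#
      all≈0 i with view i
      ... | ‵fromℕ     = aₘ≈0
      ... | ‵inject₁ j = a≈0 j
    ...   | inj₂ (j , b , j<m , ψ , ψ-low , eq) = inj₂ (j , b , ℕP.m≤n⇒m≤1+n j<m , ψ , ψ-low , λ v →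
      ≋-trans (·-cong refl (≋-trans (combination-last m a v) (⊕-identityʳ (0·v _ aₘ≈0)))) (eq v))

    -- A nontrivial relation would be a monic polynomial of degree below `n` that kills `u`, hence
    -- every vector, against minimality.
    independent : ∀ u → (∀ φ → IsPoly φ → φ u ≋ 𝟘 → ∀ v → φ v ≋ 𝟘) → ∀ a → combination n a u ≋ 𝟘 → a ≋ 𝟘
    independent u u-gen a Σ≋0 with trivial-or-monic n a
    ... | inj₁ a≈0 = a≈0
    ... | inj₂ (j , b , j<n , monic) = ⊥-elim (cyclic⇒no-small-annihilator cyclic j j<n monic
      (u-gen _ (monic-poly j monic) (≋-trans (·-cong refl Σ≋0) (·-𝟘 b))))

  -- The four eigenvalues, as a function of `ω`: when `z` is a k-th root of `ω`, `node z` lists k-th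
  -- roots of all of them.
  node : Carrier → Fin 4 → Carrier
  node ω 0F = 0#
  node ω 1F = 1#
  node ω 2F = ω
  node ω 3F = ω * ω

  node-injective : ∀ {ω} → ¬ (ω ≈ 0#) → ¬ (ω * ω ≈ 1#) → ∀ {i j} → node ω i ≈ node ω j → i ≡ j
  node-injective {ω} ω≉0 ω²≉1 = inj _ _
    where
    ω≉1 : ¬ (ω ≈ 1#)
    ω≉1 eq = ω²≉1 (trans (*-cong eq eq) (*-identityˡ 1#))
    ω≉ω² : ¬ (ω ≈ ω * ω)
    ω≉ω² eq = ω≉1 (sym (*-cancelˡ-≉0 ω≉0 (trans (*-identityʳ ω) eq)))
    inj : ∀ i j → node ω i ≈ node ω j → i ≡ j
    inj 0F 0F _  = ≡.refl
    inj 1F 1F _  = ≡.refl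
    inj 2F 2F _  = ≡.refl
    inj 3F 3F _  = ≡.refl
    inj 0F 1F eq = ⊥-elim (0≉1 eq)
    inj 1F 0F eq = ⊥-elim (0≉1 (sym eq))
    inj 0F 2F eq = ⊥-elim (ω≉0 (sym eq))
    inj 2F 0F eq = ⊥-elim (ω≉0 eq)
    inj 0F 3F eq = ⊥-elim (*-≉0 ω≉0 ω≉0 (sym eq))
    inj 3F 0F eq = ⊥-elim (*-≉0 ω≉0 ω≉0 eq)
    inj 1F 2F eq = ⊥-elim (ω≉1 (sym eq))
    inj 2F 1F eq = ⊥-elim (ω≉1 eq)
    inj 1F 3F eq = ⊥-elim (ω²≉1 (sym eq))
    inj 3F 1F eq = ⊥-elim (ω²≉1 eq)
    inj 2F 3F eq = ⊥-elim (ω≉ω² eq)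
    inj 3F 2F eq = ⊥-elim (ω≉ω² (sym eq))

  -- Indices into `node`: `1F` at positions below `j`, then `0F`. Working with indices makes it
  -- plain that `ξ` never takes the values at `2F` and `3F`.
  ones : ℕ → ℕ → Fin 4
  ones zero    _       = 0F
  ones (suc j) zero    = 1F
  ones (suc j) (suc i) = ones j i

  ones≢2 : ∀ j i → ones j i ≢ 2F
  ones≢2 (suc j) (suc i) eq = ones≢2 j i eq

  ones≢3 : ∀ j i → ones j i ≢ 3F
  ones≢3 (suc j) (suc i) eq = ones≢3 j i eq

  ∑-ones : ∀ ω j m → j ≤ m → ∑ m (λ i → node ω (ones j (toℕ i))) ≈ ι j
  ∑-ones ω zero    m       _         = ∑-0 m (λ _ → refl)
  ∑-ones ω (suc j) (suc m) (s≤s j≤m) = +-congˡ (∑-ones ω j m j≤m)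

  alternating : ℕ → Bool
  alternating zero    = false
  alternating (suc i) = not (alternating i)

  alternating-double : ∀ i → alternating (i ℕ.+ i) ≡ false
  alternating-double zero    = ≡.refl
  alternating-double (suc i) rewrite ℕP.+-suc i i | alternating-double i = ≡.refl

  module Splitting (ω z : Carrier) (k : ℕ) (zᵏ≈ω : z ^ᶠ suc k ≈ ω) (ω≉0 : ¬ (ω ≈ 0#)) (ω²≉1 : ¬ (ω * ω ≈ 1#))
    (j : ℕ) (j≤n′ : j ≤ n′) (trace-eq : ι j + (∑ n′ (λ _ → ω) + (ω + ω * ω)) ≈ trace F A)
    (u : V) (u-gen : ∀ φ → IsPoly φ → φ u ≋ 𝟘 → ∀ v → φ v ≋ 𝟘) where

    ξ α : ℕ → Carrier
    ξ i = node ω (ones j i)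
    α i = ξ i + ω

    open Newton α

    w : ℕ → V
    w i = N i u

    P : M
    P r i = w (toℕ i) r

    module InBasis (Q : M) (PQ : ∀ v → apply P (apply Q v) ≋ v) (QP : ∀ v → apply Q (apply P v) ≋ v) where
      module Q = Linear (apply-linear Q)

      e : Fin n → V
      e = column (idM F)

      Q-w : ∀ i → apply Q (w (toℕ i)) ≋ e i
      Q-w i = ≋-trans (Q.cong (≋-sym (apply-basis P i))) (QP (e i))

      A′ : M
      A′ = Q *ₘ (A *ₘ P)

      trace-A′ : trace F A′ ≈ trace F A
      trace-A′ = begin
        trace F (Q *ₘ (A *ₘ P))    ≈⟨ trace-comm Q (A *ₘ P) ⟩
        trace F (A *ₘ P *ₘ Q)      ≈⟨ ∑-cong n (λ i → matrix-ext {A *ₘ P *ₘ Q} {A} (λ v → ≋-trans (apply-*ₘ (A *ₘ P) Q v) (≋-trans (apply-*ₘ A P (apply Q v)) (Linear.cong (apply-linear A) (PQ v)))) i i) ⟩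
        trace F A                  ∎

      A′-diagonal : ∀ i → A′ (inject₁ i) (inject₁ i) ≈ α (toℕ i)
      A′-diagonal i = begin
        apply Q (apply A (w (toℕ (inject₁ i)))) (inject₁ i)                   ≈⟨ Q.cong (A-N (toℕ (inject₁ i)) u) (inject₁ i) ⟩
        apply Q (α m · w m ⊕ w (suc m)) (inject₁ i)                           ≈⟨ trans (Q.+-hom (α m · w m) (w (suc m)) (inject₁ i)) (+-congʳ (Q.·-hom (α m) (w m) (inject₁ i))) ⟩
        α m * apply Q (w m) (inject₁ i) + apply Q (w (suc m)) (inject₁ i)     ≈⟨ +-cong (*-congˡ (trans (Q-w (inject₁ i) (inject₁ i)) (idM-diagonal (inject₁ i)))) next≈0 ⟩
        α m * 1# + 0#                                                         ≈⟨ trans (+-identityʳ _) (*-identityʳ _) ⟩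
        α m                                                                   ≡⟨ ≡.cong α (FinP.toℕ-inject₁ i) ⟩
        α (toℕ i)                                                             ∎
        where
        m = toℕ (inject₁ i)
        next≈0 : apply Q (w (suc m)) (inject₁ i) ≈ 0#
        next≈0 = begin
          apply Q (w (suc m)) (inject₁ i)              ≡⟨ ≡.cong (λ k → apply Q (w (suc k)) (inject₁ i)) (FinP.toℕ-inject₁ i) ⟩
          apply Q (w (toℕ (suc i))) (inject₁ i)        ≈⟨ Q-w (suc i) (inject₁ i) ⟩
          idM F (inject₁ i) (suc i)                    ≈⟨ idM-off-diagonal (λ eq → ℕP.1+n≢n (≡.sym (≡.trans (≡.sym (FinP.toℕ-inject₁ i)) (≡.cong toℕ eq)))) ⟩
          0#                                           ∎

      top = Fin.fromℕ n′

      A′-corner : A′ top top ≈ ω + ω * ω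
      A′-corner = ∙-cancelˡ (∑ n′ (λ i → α (toℕ i))) _ _ (begin
        ∑ n′ (λ i → α (toℕ i)) + A′ top top                       ≈⟨ +-congʳ (∑-cong n′ A′-diagonal) ⟨
        ∑ n′ (λ i → A′ (inject₁ i) (inject₁ i)) + A′ top top      ≈⟨ ∑-last n′ (λ i → A′ i i) ⟨
        trace F A′                                                ≈⟨ trace-A′ ⟩
        trace F A                                                 ≈⟨ trace-eq ⟨
        ι j + (∑ n′ (λ _ → ω) + (ω + ω * ω))                      ≈⟨ +-assoc _ _ _ ⟨
        ι j + ∑ n′ (λ _ → ω) + (ω + ω * ω)                        ≈⟨ +-congʳ (+-congʳ (∑-ones ω j n′ j≤n′)) ⟨
        ∑ n′ (λ i → ξ (toℕ i)) + ∑ n′ (λ _ → ω) + (ω + ω * ω)     ≈⟨ +-congʳ (∑-+ n′ _ _) ⟨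
        ∑ n′ (λ i → α (toℕ i)) + (ω + ω * ω)                      ∎)

      -- The unsteered part of the last column; it lies in the span of the `w i` with `i < n′`.
      lower : V
      lower r = ∑ n′ (λ i → w (toℕ i) r * A′ (inject₁ i) top)

      A-top : apply A (w n′) ≋ (ω + ω * ω) · w n′ ⊕ lower
      A-top r = begin
        apply A (w n′) r                                                              ≡⟨ ≡.cong (λ k → apply A (w k) r) (FinP.toℕ-fromℕ n′) ⟨
        apply A (w (toℕ top)) r                                                       ≈⟨ PQ (apply A (w (toℕ top))) r ⟨
        apply P (column A′ top) r                                                     ≈⟨ ∑-last n′ (λ i → P r i * A′ i top) ⟩
        ∑ n′ (λ i → w (toℕ (inject₁ i)) r * A′ (inject₁ i) top) + w (toℕ top) r * A′ top top
                                                                                      ≈⟨ +-cong (∑-cong n′ (λ i → *-congʳ (reflexive (≡.cong (λ k → w k r) (FinP.toℕ-inject₁ i)))))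
                                                                                                (*-cong (reflexive (≡.cong (λ k → w k r) (FinP.toℕ-fromℕ n′))) A′-corner) ⟩
        lower r + w n′ r * (ω + ω * ω)                                                ≈⟨ solve 3 (λ l x a → l :+ x :* a := a :* x :+ l) refl (lower r) (w n′ r) (ω + ω * ω) ⟩
        (ω + ω * ω) * w n′ r + lower r                                                ∎

      -- B takes the subdiagonal entries below the columns i with β i = true, C the others. The entries
      -- alternate, so each summand is made of 2 × 2 triangular blocks with distinct eigenvalues.
      β : ℕ → Bool
      β i = alternating (n′ ℕ.+ i)

      β-suc : ∀ i → β (suc i) ≡ not (β i)
      β-suc i = ≡.cong alternating (ℕP.+-suc n′ i)

      -- `n′ + n′` is even, so `β` is false at the last column and true one column earlier, if there
      -- is one. Hence the bottom subdiagonal entry belongs to `B`, and `C` maps the earlier `w i`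
      -- among themselves.
      β-top : ∀ {i} → β i ≡ true → i ≢ n′
      β-top βi ≡.refl with ≡.trans (≡.sym βi) (alternating-double n′)
      ... | ()

      -- The diagonal entry `ξ i + ω` is shared so that `ξ i` goes with the subdiagonal entry and
      -- `ω` to the other summand. The owner of that entry then has `ξ i` in column `i` and `ω` in
      -- the next one.
      B-column : ℕ → V
      B-column i = if β i then ξ i · w i ⊕ w (suc i) else ω · w i

      B C : M
      B = (λ r i → B-column (toℕ i) r) *ₘ Q
      C = A +ₘ scaleM F (- 1#) B

      A≈B+C : A ≈ₘ B +ₘ C
      A≈B+C r s = solve 2 (λ a b → a := b :+ (a :+ (:- con (+ 1)) :* b)) refl (A r s) (B r s)

      apply-B : ∀ {i} → i ≤ n′ → apply B (w i) ≋ B-column i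
      apply-B {i} i≤n′ = ≡.subst (λ k → apply B (w k) ≋ B-column k) (FinP.toℕ-fromℕ< (s≤s i≤n′)) (≋-trans (apply-*ₘ Y Q (w (toℕ f)))
        (≋-trans (Linear.cong (apply-linear Y) (Q-w f)) (apply-basis Y f)))
        where
        f = fromℕ< (s≤s i≤n′)
        Y : M
        Y r i = B-column (toℕ i) r

      apply-C : ∀ {i} → i ≤ n′ → apply C (w i) ≋ apply A (w i) ⊕ (- 1#) · B-column i
      apply-C {i} i≤n′ = ≋-trans (apply-+ₘ A (scaleM F (- 1#) B) (w i)) (⊕-cong ≋-refl
        (≋-trans (apply-scale (- 1#) B (w i)) (·-cong refl (apply-B i≤n′))))

      B-column-true : ∀ {i} → β i ≡ true → B-column i ≋ ξ i · w i ⊕ w (suc i)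
      B-column-true {i} βi r = reflexive (≡.cong (λ b → (if b then ξ i · w i ⊕ w (suc i) else ω · w i) r) βi)

      B-column-false : ∀ {i} → β i ≡ false → B-column i ≋ ω · w i
      B-column-false {i} βi r = reflexive (≡.cong (λ b → (if b then ξ i · w i ⊕ w (suc i) else ω · w i) r) βi)

      C-true : ∀ {i} → i ≤ n′ → β i ≡ true → apply C (w i) ≋ ω · w i
      C-true {i} i≤n′ βi r = begin
        apply C (w i) r                                            ≈⟨ apply-C i≤n′ r ⟩
        apply A (w i) r + (- 1#) * B-column i r                    ≈⟨ +-cong (A-N i u r) (*-congˡ (B-column-true βi r)) ⟩
        (ξ i + ω) * w i r + w (suc i) r + (- 1#) * (ξ i * w i r + w (suc i) r)
                                                                   ≈⟨ solve 4 (λ x o v y → (x :+ o) :* v :+ y :+ (:- con (+ 1)) :* (x :* v :+ y) := o :* v) refl (ξ i) ω (w i r) (w (suc i) r) ⟩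
        ω * w i r                                                  ∎

      C-false : ∀ {i} → i ≤ n′ → β i ≡ false → apply C (w i) ≋ ξ i · w i ⊕ w (suc i)
      C-false {i} i≤n′ βi r = begin
        apply C (w i) r                                            ≈⟨ apply-C i≤n′ r ⟩
        apply A (w i) r + (- 1#) * B-column i r                    ≈⟨ +-cong (A-N i u r) (*-congˡ (B-column-false βi r)) ⟩
        (ξ i + ω) * w i r + w (suc i) r + (- 1#) * (ω * w i r)     ≈⟨ solve 4 (λ x o v y → (x :+ o) :* v :+ y :+ (:- con (+ 1)) :* (o :* v) := x :* v :+ y) refl (ξ i) ω (w i r) (w (suc i) r) ⟩
        ξ i * w i r + w (suc i) r                                  ∎

      C-top : apply C (w n′) ≋ (ω * ω) · w n′ ⊕ lower
      C-top r = begin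
        apply C (w n′) r                                            ≈⟨ apply-C ℕP.≤-refl r ⟩
        apply A (w n′) r + (- 1#) * B-column n′ r                   ≈⟨ +-cong (A-top r) (*-congˡ (B-column-false (alternating-double n′) r)) ⟩
        (ω + ω * ω) * w n′ r + lower r + (- 1#) * (ω * w n′ r)      ≈⟨ solve 4 (λ o s v y → (o :+ s) :* v :+ y :+ (:- con (+ 1)) :* (o :* v) := s :* v :+ y) refl ω (ω * ω) (w n′ r) (lower r) ⟩
        ω * ω * w n′ r + lower r                                    ∎

      nodes-injective : ∀ {i j} → node ω i ≈ node ω j → i ≡ j
      nodes-injective = node-injective ω≉0 ω²≉1

      module _ (X : M) where
        open Eigenvectors F isField n X (node ω) nodes-injective

        Diagonal : V → Set (c ⊔ ℓ)
        Diagonal = Span (λ _ → ⊤)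

        -- `w (suc i)` is an eigenvector for `ω`, and `ξ i` differs from `ω`, so the block splits.
        -- Leaving out `3F` keeps `ω * ω` free for the last column of `C`.
        block : ∀ {i} → apply X (w i) ≋ ξ i · w i ⊕ w (suc i) → apply X (w (suc i)) ≋ ω · w (suc i) → Span (_≢ 3F) (w i)
        block {i} head tail = span-extend {E = _≡ 2F} {j = ones j i} (ones≢2 j i) (λ { ≡.refl () }) (ones≢3 j i)
          (eigenvector 2F ≡.refl tail) head

        basis⇒power : (∀ i → i ≤ n′ → Diagonal (w i)) → ∃ λ G → X ≈ₘ G ^ₘ suc k
        basis⇒power spans = Roots.diagonalisable⇒power F isField n X (node ω) (node z) nodes-injective (suc k) roots
          (λ v → sum (span-combination n (λ t → w (toℕ t)) (apply Q v) (λ t → spans (toℕ t) (ℕP.≤-pred (FinP.toℕ<n t))))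
            (null {v = 𝟘} ≋-refl) (≋-trans (≋-sym (PQ v)) (≋-sym (⊕-identityʳ ≋-refl))))
          where
          roots : ∀ i → node z i ^ᶠ suc k ≈ node ω i
          roots 0F = zeroˡ _
          roots 1F = 1^n≈1 (suc k)
          roots 2F = zᵏ≈ω
          roots 3F = trans (^-distrib-* z z (suc k)) (*-cong zᵏ≈ω zᵏ≈ω)

      <n′ : ∀ {i} → i ≤ n′ → β i ≡ true → suc i ≤ n′
      <n′ i≤n′ βi = ℕP.≤∧≢⇒< i≤n′ (β-top βi)

      B-power : ∃ λ G → B ≈ₘ G ^ₘ suc k
      B-power = basis⇒power B spans
        where
        open Eigenvectors F isField n B (node ω) nodes-injective
        spans : ∀ i → i ≤ n′ → Diagonal B (w i)
        spans i i≤n′ with β i in βi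
        ... | false = eigenvector 2F tt (≋-trans (apply-B i≤n′) (B-column-false βi))
        ... | true  = span-mono (λ _ → tt) (block B (≋-trans (apply-B i≤n′) (B-column-true βi))
          (≋-trans (apply-B (<n′ i≤n′ βi)) (B-column-false (≡.trans (β-suc i) (≡.cong not βi)))))

      C-power : ∃ λ G → C ≈ₘ G ^ₘ suc k
      C-power = basis⇒power C spans
        where
        open Eigenvectors F isField n C (node ω) nodes-injective
        proper : ∀ i → i < n′ → Span (_≢ 3F) (w i)
        proper i i<n′ with β i in βi
        ... | true  = eigenvector 2F (λ ()) (C-true (ℕP.<⇒≤ i<n′) βi)
        ... | false = block C (C-false (ℕP.<⇒≤ i<n′) βi) (C-true i<n′ (≡.trans (β-suc i) (≡.cong not βi)))
        spans : ∀ i → i ≤ n′ → Diagonal C (w i)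
        spans i i≤n′ with ℕP.m≤n⇒m<n∨m≡n i≤n′
        ... | inj₁ i<n′   = span-mono (λ _ → tt) (proper i i<n′)
        -- `lower` combines vectors whose spans omit `3F`, so the corner `ω * ω` is a new eigenvalue
        -- whatever the last column contains.
        ... | inj₂ ≡.refl = span-extend {E = _≢ 3F} {j = 3F} (λ 3≢3 → 3≢3 ≡.refl) (λ _ → tt) tt
          (span-combination n′ (λ t → w (toℕ t)) (λ t → A′ (inject₁ t) top) (λ t → proper (toℕ t) (FinP.toℕ<n t))) C-top

      sum-of-basis-powers : ∃₂ λ B C → A ≈ₘ B ^ₘ suc k +ₘ C ^ₘ suc k
      sum-of-basis-powers = proj₁ B-power , proj₁ C-power , λ r s →
        trans (A≈B+C r s) (+-cong (proj₂ B-power r s) (proj₂ C-power r s))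

    sum-of-powers : ∃₂ λ B C → A ≈ₘ B ^ₘ suc k +ₘ C ^ₘ suc k
    sum-of-powers = let (Q , PQ , QP) = inverse P (independent u u-gen) in InBasis.sum-of-basis-powers Q PQ QP

-- Assembly of the theorem.

open import Data.Nat using (_^_)

module Assembly {c ℓ} (F : CommutativeRing c ℓ) (isField : IsField F) where
  open CommutativeRing F hiding (zero)
  open FieldProperties F isField using (ι; ι-+; ι-*; ι-^; x*y≈0⇒y≈0; 0≉1) renaming (_^_ to _^ᶠ_)
  open Sums F using (∑)

  subfield-+ : ∀ {x y} → InPrimeSubfield F x → InPrimeSubfield F y → InPrimeSubfield F (x + y)
  subfield-+ (a , x≈a) (b , y≈b) = a ℕ.+ b , trans (+-cong x≈a y≈b) (sym (ι-+ a b))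

  subfield-* : ∀ {x y} → InPrimeSubfield F x → InPrimeSubfield F y → InPrimeSubfield F (x * y)
  subfield-* (a , x≈a) (b , y≈b) = a ℕ.* b , trans (*-cong x≈a y≈b) (sym (ι-* a b))

  subfield-∑ : ∀ m {f} → (∀ i → InPrimeSubfield F (f i)) → InPrimeSubfield F (∑ m f)
  subfield-∑ zero    _  = 0 , refl
  subfield-∑ (suc m) f∈ = subfield-+ (f∈ zero) (subfield-∑ m (f∈ ∘ suc))

  -- A field has no nilpotents. From `ι (p ^ l) = ι q = 0` this extracts `ι p = 0`, that is, the
  -- characteristic.
  ^≈0⇒≈0 : (∀ x → Dec (x ≈ 0#)) → ∀ {x} m → x ^ᶠ m ≈ 0# → x ≈ 0#
  ^≈0⇒≈0 zero? zero    1≈0 = ⊥-elim (0≉1 (sym 1≈0))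
  ^≈0⇒≈0 zero? {x} (suc m) xxᵐ≈0 with zero? x
  ... | yes x≈0 = x≈0
  ... | no  x≉0 = ^≈0⇒≈0 zero? m (x*y≈0⇒y≈0 x≉0 xxᵐ≈0)

  -- Predecessors replace the truncated differences, and `suc q′` is tied to the power of `p` by an
  -- equation, so that the cardinality has the successor form which the finite field modules expect.
  sum-of-two-powers : ∀ p′ l n′ k q′ → p′ ≢ 0 → q′ ≢ 0 → suc q′ ≡ suc p′ ^ l → Prime (suc p′) → HasCard F (suc q′) →
    3 ≤ gcd (divNat q′ (gcd (suc k) q′)) p′ → p′ ≤ n′ →
    (A : Mat F (suc n′)) → Cyclic F A → InPrimeSubfield F (trace F A) →
    ∃₂ λ (B C : Mat F (suc n′)) → _≈M_ F A (_+M_ F (_^M_ F B (suc k)) (_^M_ F C (suc k)))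
  sum-of-two-powers p′ l n′ k q′ p′≢0 q′≢0 q≡ p-prime card 3≤h p′≤n′ A cyclic tr∈ =
    let (ω , z , zᵏ≈ω , ω∈ , ω≉0 , ω²≉1) = power-in-prime-subfield (suc k) (s≤s z≤n) 3≤h
        -- The forced part of the trace: `ω` at each of the `n′` free positions and `ω + ω * ω` in
        -- the corner. The ones among the `ξ` make up the difference.
        (j , j≤p′ , trace-eq) = solve-ι
          (subfield-+ (subfield-∑ n′ (λ _ → ω∈)) (subfield-+ ω∈ (subfield-* ω∈ ω∈))) tr∈
    in FiniteMatrices.sum-of-powers-stable F isField q′ card (suc n′) A (suc k) λ none →
         cyclic⇒generator cyclic λ (u , u-gen) →
           none (Splitting.sum-of-powers ω z k zᵏ≈ω ω≉0 ω²≉1 j (ℕP.≤-trans j≤p′ p′≤n′) trace-eq u u-gen)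
    where
    open FiniteField F isField q′ card
    p≈0 : ι (suc p′) ≈ 0#
    p≈0 = ^≈0⇒≈0 (_≈? 0#) l (trans (sym (ι-^ (suc p′) l)) (trans (reflexive (≡.cong ι (≡.sym q≡))) ι-card))
    open Characteristic p′ p-prime p≈0
    open Evaluation F isField _≈?_ (suc n′) A using (cyclic⇒generator)
    open Decomposition F isField q′ card n′ A cyclic using (module Splitting)
    instance
      p′-nonZero : NonZero p′
      p′-nonZero = ℕ.≢-nonZero p′≢0
      q′-nonZero : NonZero q′
      q′-nonZero = ℕ.≢-nonZero q′≢0

theorem1p13 : ∀ {c ℓ} (F : CommutativeRing c ℓ) → IsField F →
    (p l n k : ℕ) → Prime p → 1 ≤ l → HasCard F (p ^ l) → 2 ≤ n → 1 ≤ k →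
    3 ≤ gcd (divNat (p ^ l ∸ 1) (gcd k (p ^ l ∸ 1))) (p ∸ 1) →
    p ∸ 1 < n →
    (A : Mat F n) → Cyclic F A → InPrimeSubfield F (trace F A) →
    ∃₂ λ (B C : Mat F n) → _≈M_ F A (_+M_ F (_^M_ F B k) (_^M_ F C k))
theorem1p13 F isField (suc (suc p″)) l (suc n′) (suc k) p-prime 1≤l card _ _ 3≤h (s≤s p′≤n′) A cyclic tr∈
  = main (suc (suc p″) ^ l) ≡.refl card 3≤h
  where
  p≤q : suc (suc p″) ℕ.* 1 ≤ suc (suc p″) ^ l
  p≤q = ℕP.^-monoʳ-≤ (suc (suc p″)) 1≤l
  -- The power of `p` shows no constructor, so it is abstracted to `q`; the values 0 and 1
  -- contradict `2 ≤ p ≤ q`.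
  main : ∀ q → q ≡ suc (suc p″) ^ l → HasCard F q → 3 ≤ gcd (divNat (q ∸ 1) (gcd (suc k) (q ∸ 1))) (suc p″) → _
  main zero       q≡ _ _ with () ← ≡.subst (_ ≤_) (≡.sym q≡) p≤q
  main (suc zero) q≡ _ _ with s≤s () ← ≡.subst (_ ≤_) (≡.sym q≡) p≤q
  main (suc (suc q″)) q≡ card 3≤h = Assembly.sum-of-two-powers F isField (suc p″) l n′ k (suc q″) (λ ()) (λ ()) q≡ p-prime card 3≤h p′≤n′ A cyclic tr∈
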